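{- Let $m,n$ be positive integers with $m+n$ odd, let $G=G^{(m,n)}$ and $k=\frac{m+n+1}{2}$. Then there is a bijection between the set $\mathcal{D}(G)$ of dimer coverings of $G$ and the set $\mathcal{F}(G,P)$ of triples $(F_1,F_2,\{e_j\}_{j=1}^k)$ such that: $F_j$ is a spanning forest of $G_j$ with exactly $k$ connected components ($j=1,2$); $\{e_j\}_{j=1}^k\subset E_2$ is a set of $k$ edges (the configuration of impurities); and condition (P) holds: (P)(1) $F_1$ and $F_2$ have no intersections, i.e. no vertex of $V_3$ is the middle vertex of both an edge of $F_1$ and an edge of $F_2$; (P)(2) the trees of $F_1$ are paired with those of $F_2$ by the impurities, i.e. each tree of $F_1$ contains the $V_1$-endpoint of exactly one $e_j$, and each tree of $F_2$ contains the $V_2$-endpoint of exactly one $e_j$.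
   Context: Let $\mathcal{G}$ be the graph with vertex set $\mathcal{V}=\mathbb{Z}^2\cup(\mathbb{Z}^2+(\frac12,\frac12))$ in which two vertices are adjacent iff their Euclidean distance is $1$ or $\frac{\sqrt2}{2}$; edges are unoriented. Put $\mathcal{V}_1=\{(x,y)\in\mathbb{Z}^2: x-y\in 2\mathbb{Z}\}$, $\mathcal{V}_2=\{(x,y)\in\mathbb{Z}^2: x-y\in 2\mathbb{Z}+1\}$, $\mathcal{V}_3=\mathbb{Z}^2+(\frac12,\frac12)$; let $\mathcal{E}_1$ be the edges joining a point of $\mathbb{Z}^2$ to a point of $\mathcal{V}_3$ and $\mathcal{E}_2$ the edges joining two points of $\mathbb{Z}^2$ (so every edge of $\mathcal{E}_2$ joins a point of $\mathcal{V}_1$ to a point of $\mathcal{V}_2$). For a finite subgraph $G$ of $\mathcal{G}$ put $V_i=V(G)\cap\mathcal{V}_i$, $E_i=E(G)\cap\mathcal{E}_i$. A dimer covering of $G$ is a set $M\subset E(G)$ such that every vertex of $G$ lies in exactly one edge of $M$ (a perfect matching); the edges of $M\cap E_2$ are called impurities. $G^{(m,n)}$ is the subgraph of $\mathcal{G}$ induced by $\{(x,y)\in\mathbb{Z}^2:0\le x\le m,\,0\le y\le n\}\cup\{(x+\frac12,y+\frac12):x,y\in\mathbb{Z},\,0\le x\le m-1,\,0\le y\le n-1\}$ (an $m\times n$ rectangle of unit squares together with their centers); every dimer covering of it has exactly $\frac{m+n+1}{2}$ impurities, which forces $m+n$ odd. For $j=1,2$, $G_j$ is the graph with vertex set $V_j$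 in which $x,y\in V_j$ are adjacent iff there is $z\in V_3$ adjacent in $G$ to both $x$ and $y$; $z$ is called the middle vertex of the edge $(x,y)$ (so edges of $G_j$ are diagonals of unit squares of the rectangle, with the square's center as middle vertex).
   Formalization: The graph G is taken with edge set E₁ ∪ E₂ only: edges between two centers at distance 1, which the literal distance rule would allow, are excluded, since with them the claim fails (e.g. m=1, n=2 has 3 extra coverings, each with 3 ≠ k = 2 impurities). -}

module Defs where

open import Level using (0ℓ)
open import Data.Nat using (ℕ; zero; suc; _+_)
open import Data.Nat.Divisibility using (_∣_)
open import Data.Fin using (Fin; zero; suc; toℕ; inject₁; fromℕ)
open import Data.Bool using (Bool; true; false; if_then_else_)
open import Data.Product using (Σ; ∃; _×_; _,_; proj₁; proj₂; ∃!)
open import Data.Sum using (_⊎_; inj₁; inj₂)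
open import Relation.Nullary using (¬_)
open import Relation.Binary using (Setoid)
open import Relation.Binary.PropositionalEquality using (_≡_; _≢_; refl; sym; trans)
open import Relation.Binary.Construct.Closure.ReflexiveTransitive using (Star)

Pt : ℕ → ℕ → Set
Pt m n = Fin (suc m) × Fin (suc n)

-- Center (a , b) stands for the point (a + 1/2 , b + 1/2), 0 ≤ a < m, 0 ≤ b < n.
Ctr : ℕ → ℕ → Set
Ctr m n = Fin m × Fin n

Vertex : ℕ → ℕ → Set
Vertex m n = Pt m n ⊎ Ctr m n

data Corner : Set where
  SW SE NW NE : Corner

cornerPt : ∀ {m n} → Ctr m n → Corner → Pt m n
cornerPt (a , b) SW = inject₁ a , inject₁ b
cornerPt (a , b) SE = suc a , inject₁ b
cornerPt (a , b) NW = inject₁ a , suc b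
cornerPt (a , b) NE = suc a , suc b

-- Edges of E₁ (lattice point – center, distance √2/2):
-- one per (center, corner) pair.
E1 : ℕ → ℕ → Set
E1 m n = Ctr m n × Corner

-- Edges of E₂ (lattice point – lattice point, distance 1), unoriented:
-- hor x y joins (x , y) and (x+1 , y); ver x y joins (x , y) and (x , y+1).
data E2 (m n : ℕ) : Set where
  hor : Fin m → Fin (suc n) → E2 m n
  ver : Fin (suc m) → Fin n → E2 m n

ends : ∀ {m n} → E2 m n → Pt m n × Pt m n
ends (hor x y) = (inject₁ x , y) , (suc x , y)
ends (ver x y) = (x , inject₁ y) , (x , suc y)

Edge : ℕ → ℕ → Set
Edge m n = E1 m n ⊎ E2 m n

Incident : ∀ {m n} → Vertex m n → Edge m n → Set
Incident v (inj₁ (c , k)) = (v ≡ inj₁ (cornerPt c k)) ⊎ (v ≡ inj₂ c)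
Incident v (inj₂ e)       = (v ≡ inj₁ (proj₁ (ends e))) ⊎ (v ≡ inj₁ (proj₂ (ends e)))

IsDimer : ∀ {m n} → (Edge m n → Bool) → Set
IsDimer {m} {n} M = ∀ (v : Vertex m n) → ∃! _≡_ (λ e → M e ≡ true × Incident v e)

-- The classes V₁, V₂ (x - y even / odd, equivalently x + y even / odd).
data Cls : Set where
  one two : Cls

InV : ∀ {m n} → Cls → Pt m n → Set
InV one (x , y) = 2 ∣ (toℕ x + toℕ y)
InV two (x , y) = ¬ (2 ∣ (toℕ x + toℕ y))

IsCorner : ∀ {m n} → Pt m n → Ctr m n → Set
IsCorner p c = Σ Corner λ k → cornerPt c k ≡ p

-- A subgraph F of G_j (with vertex set V_j) is given by the set of middle
-- vertices of its edges (each center is the middle vertex of exactly one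
-- edge of G_j).  Adjacency in F: p ≠ q in V_j, with a common neighbour
-- c ∈ V₃ that is the middle vertex of an edge of F.
FAdj : ∀ {m n} → Cls → (Ctr m n → Bool) → Pt m n → Pt m n → Set
FAdj {m} {n} j F p q =
  Σ (Ctr m n) λ c → F c ≡ true × IsCorner p c × IsCorner q c × p ≢ q × InV j p × InV j q

Connected : ∀ {m n} → Cls → (Ctr m n → Bool) → Pt m n → Pt m n → Set
Connected j F = Star (FAdj j F)

Acyclic : {A : Set} → (A → A → Set) → Set
Acyclic {A} R = ∀ (ℓ : ℕ) (v : Fin (3 + ℓ) → A) →
  (∀ i i′ → v i ≡ v i′ → i ≡ i′) →
  (∀ (i : Fin (2 + ℓ)) → R (v (inject₁ i)) (v (suc i))) →
  ¬ R (v (fromℕ (2 + ℓ))) (v zero)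

VSet : ℕ → ℕ → Cls → Set
VSet m n j = Σ (Pt m n) (InV j)

HasComponents : ∀ {m n} → Cls → (Ctr m n → Bool) → ℕ → Set
HasComponents {m} {n} j F k =
  Σ (VSet m n j → Fin k) λ f →
    (∀ i → ∃ λ p → f p ≡ i) ×
    (∀ p q → (f p ≡ f q → Connected j F (proj₁ p) (proj₁ q))
           × (Connected j F (proj₁ p) (proj₁ q) → f p ≡ f q))

SpanningForest : ∀ {m n} → Cls → (Ctr m n → Bool) → ℕ → Set
SpanningForest j F k = Acyclic (FAdj j F) × HasComponents j F k

sumFin : ∀ {n} → (Fin n → ℕ) → ℕ
sumFin {zero}  f = 0
sumFin {suc n} f = f zero + sumFin (λ i → f (suc i))

ind : Bool → ℕ
ind b = if b then 1 else 0

countE2 : ∀ {m n} → (E2 m n → Bool) → ℕ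
countE2 I = sumFin (λ x → sumFin (λ y → ind (I (hor x y))))
          + sumFin (λ x → sumFin (λ y → ind (I (ver x y))))

IsEnd : ∀ {m n} → Pt m n → E2 m n → Set
IsEnd q e = (q ≡ proj₁ (ends e)) ⊎ (q ≡ proj₂ (ends e))

P1 : ∀ {m n} → (Ctr m n → Bool) → (Ctr m n → Bool) → Set
P1 F₁ F₂ = ∀ c → ¬ (F₁ c ≡ true × F₂ c ≡ true)

OneImpurity : ∀ {m n} → Cls → (Ctr m n → Bool) → (E2 m n → Bool) → Pt m n → Set
OneImpurity {m} {n} j F I p =
  ∃! _≡_ (λ e → I e ≡ true × Σ (Pt m n) λ q → IsEnd q e × InV j q × Connected j F q p)

P2 : ∀ {m n} → (Ctr m n → Bool) → (Ctr m n → Bool) → (E2 m n → Bool) → Set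
P2 {m} {n} F₁ F₂ I =
  (∀ (p : Pt m n) → InV one p → OneImpurity one F₁ I p) ×
  (∀ (p : Pt m n) → InV two p → OneImpurity two F₂ I p)

IsTriple : ∀ {m n} → ℕ → (Ctr m n → Bool) → (Ctr m n → Bool) → (E2 m n → Bool) → Set
IsTriple k F₁ F₂ I =
  SpanningForest one F₁ k × SpanningForest two F₂ k × countE2 I ≡ k × P1 F₁ F₂ × P2 F₁ F₂ I

Dimers : ℕ → ℕ → Set
Dimers m n = Σ (Edge m n → Bool) IsDimer

Triples : ℕ → ℕ → ℕ → Set
Triples m n k =
  Σ (Ctr m n → Bool) λ F₁ → Σ (Ctr m n → Bool) λ F₂ → Σ (E2 m n → Bool) λ I →
    IsTriple k F₁ F₂ I

DimerSetoid : ℕ → ℕ → Setoid 0ℓ 0ℓ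
DimerSetoid m n = record
  { Carrier = Dimers m n
  ; _≈_ = λ M M′ → ∀ e → proj₁ M e ≡ proj₁ M′ e
  ; isEquivalence = record
    { refl = λ e → refl
    ; sym = λ p e → sym (p e)
    ; trans = λ p q e → trans (p e) (q e) } }

_≈T_ : ∀ {m n k} → Triples m n k → Triples m n k → Set
(F₁ , F₂ , I , _) ≈T (F₁′ , F₂′ , I′ , _) =
  (∀ c → F₁ c ≡ F₁′ c) × (∀ c → F₂ c ≡ F₂′ c) × (∀ e → I e ≡ I′ e)

TripleSetoid : ℕ → ℕ → ℕ → Setoid 0ℓ 0ℓ
TripleSetoid m n k = record
  { Carrier = Triples m n k
  ; _≈_ = _≈T_
  ; isEquivalence = record
    { refl = (λ _ → refl) , (λ _ → refl) , (λ _ → refl)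
    ; sym = λ (a , b , c) → (λ x → sym (a x)) , (λ x → sym (b x)) , (λ x → sym (c x))
    ; trans = λ (a , b , c) (a′ , b′ , c′) →
        (λ x → trans (a x) (a′ x)) , (λ x → trans (b x) (b′ x)) , (λ x → trans (c x) (c′ x)) } }

{-# OPTIONS --safe #-}

-- In a dimer covering each center is matched to one of its corners; directing the diagonal
-- of its square away from that corner gives every lattice point not on an impurity one
-- outgoing diagonal, inside its own class.  The main point is that there is no directed
-- cycle.  In the coordinates u = x + y, v = x − y all vertices lie on ℤ² and a cycle is a
-- simple closed lattice curve.  The sum mod 2 of its winding numbers around all vertices of
-- the graph is even (a lattice point cancels with the center to its upper right, up to a
-- telescoping term), whereas the sum around the vertices of the curve itself is odd, by
-- Hopf's argument for the rotation number applied to pairs of points of the curve.  So the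
-- sum over the vertices off the curve is odd, but matched vertices off the curve lie on the
-- same side of it and cancel in pairs.
--
-- Conversely, a triple is oriented towards the impurities along shortest paths.  This maps
-- the (m + 1)(n + 1) − 2k = mn points outside impurities injectively to the mn centers,
-- hence every center is matched.
module Submission where

open import Defs
open import Data.Bool using (Bool; true; false; not; _∧_; _∨_; _xor_; if_then_else_)
import Data.Bool.Properties as Bool
open import Data.Bool.Properties using (xor-assoc; xor-comm; xor-same; xor-identityˡ; xor-identityʳ; xor-inverseˡ; xor-inverseʳ; ∧-zeroʳ; ∧-identityʳ; ∧-distribʳ-xor; not-involutive)
open import Data.Empty using (⊥; ⊥-elim)
open import Data.Fin using (Fin; zero; suc; toℕ; inject₁; fromℕ; combine)
open import Data.Fin.Properties using (toℕ-inject₁; toℕ-fromℕ; toℕ-injective; toℕ<n; toℕ≤pred[n]; pigeonhole; combine-injective) renaming (_≟_ to _≟F_)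
open import Data.Fin.Relation.Unary.Top using (view; ‵fromℕ; ‵inject₁)
open import Data.List using (List; []; _∷_; _++_; map; tabulate; allFin; cartesianProduct; lookup; filter; length)
open import Data.List.Membership.Propositional using (_∈_; find; lose)
open import Data.List.Membership.Propositional.Properties using (∈-allFin; ∈-cartesianProduct⁺; ∈-map⁺; ∈-map⁻; ∈-++⁺ˡ; ∈-++⁺ʳ; ∈-lookup; ∈-filter⁺; ∈-filter⁻)
open import Data.List.Relation.Unary.All using ([]; _∷_)
open import Data.List.Relation.Unary.AllPairs using ([]; _∷_)
open import Data.List.Relation.Unary.Any using (here; there; index; any?)
open import Data.List.Relation.Unary.Any.Properties using (lookup-index)
open import Data.List.Relation.Unary.Unique.Propositional using (Unique)
open import Data.List.Relation.Unary.Unique.Propositional.Properties using (allFin⁺; cartesianProduct⁺; map⁺; ++⁺; filter⁺; Unique[x∷xs]⇒x∉xs)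
open import Data.Maybe using (Maybe; just; nothing)
open import Data.Maybe.Properties using (just-injective) renaming (≡-dec to Maybe-≡-dec)
open import Data.Nat using (ℕ; zero; suc; _+_; _*_; _∸_; _%_; _/_; _<_; _≤_; _<ᵇ_; _≡ᵇ_; z≤n; s≤s; s≤s⁻¹; z<s; s<s)
open import Data.Nat.Divisibility using (_∣_; divides; ∣m∣n⇒∣m+n; ∣-refl; _∣0)
open import Data.Nat.DivMod using (m≡m%n+[m/n]*n; m%n<n)
open import Data.Nat.Induction using (<-rec)
open import Data.Nat.Properties
open import Data.Product using (Σ; ∃; _×_; _,_; proj₁; proj₂; uncurry)
open import Data.Product.Properties using () renaming (≡-dec to ×-≡-dec)
open import Data.Sum using (_⊎_; inj₁; inj₂; [_,_]′; swap)
open import Data.Sum.Properties using (inj₁-injective; inj₂-injective) renaming (≡-dec to ⊎-≡-dec)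
open import Function using (_∘_; id; case_of_)
open import Function.Bundles using (Bijection)
open import Relation.Binary using (DecidableEquality; tri<; tri≈; tri>)
open import Relation.Binary.Construct.Closure.ReflexiveTransitive using (ε; _◅_; _◅◅_; reverse)
open import Relation.Binary.PropositionalEquality using (_≡_; _≢_; ≢-sym; refl; sym; trans; cong; cong₂; subst; subst₂; module ≡-Reasoning)
open import Relation.Nullary using (¬_; Dec; yes; no; does; contradiction)
open import Relation.Nullary.Decidable using (map′; _×-dec_; _⊎-dec_; dec-true)
open import Relation.Unary using (Decidable)

-- The natural argument would count the vertices enclosed by a cycle, which presupposes an interior
-- and hence the Jordan curve theorem. The interior is replaced here by the parity of the winding
-- number, a plain count of crossings with one ray. A ray at half-integer height meets no lattice
-- point, so the count also makes sense around vertices of the curve itself. There its value depends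
-- on the ray, but in return the total over all vertices becomes a sum over the steps of the curve
-- and can be evaluated one diagonal at a time.
--
-- Injectivity of the bijection is a separate matter. A triple fixes which diagonal of each square
-- is used and leaves only its direction open. The impurities force the directions, by induction on
-- the number of steps that separate a point from its impurity.

-- Boolean comparison of natural numbers

<ᵇ-true : ∀ {a b} → a < b → (a <ᵇ b) ≡ true
<ᵇ-true {zero}  (s≤s _) = refl
<ᵇ-true {suc a} (s≤s a<b@(s≤s _)) = <ᵇ-true a<b

<ᵇ-false : ∀ {a b} → b ≤ a → (a <ᵇ b) ≡ false
<ᵇ-false z≤n       = refl
<ᵇ-false (s≤s b≤a) = <ᵇ-false b≤a

<ᵇ-true⁻ : ∀ a b → (a <ᵇ b) ≡ true → a < b
<ᵇ-true⁻ zero    (suc b) _ = z<s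
<ᵇ-true⁻ (suc a) (suc b) e = s<s (<ᵇ-true⁻ a b e)

≡ᵇ-refl : ∀ a → (a ≡ᵇ a) ≡ true
≡ᵇ-refl zero    = refl
≡ᵇ-refl (suc a) = ≡ᵇ-refl a

≡ᵇ-true⁻ : ∀ a b → (a ≡ᵇ b) ≡ true → a ≡ b
≡ᵇ-true⁻ zero    zero    _ = refl
≡ᵇ-true⁻ (suc a) (suc b) e = cong suc (≡ᵇ-true⁻ a b e)

≡ᵇ-false : ∀ {a b} → a ≢ b → (a ≡ᵇ b) ≡ false
≡ᵇ-false {a} {b} ne with a ≡ᵇ b in e
... | true  = contradiction (≡ᵇ-true⁻ a b e) ne
... | false = refl

-- Finite sums over ℤ/2.

⨁ : ℕ → (ℕ → Bool) → Bool
⨁ zero    f = false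
⨁ (suc n) f = ⨁ n f xor f n

xor-interchange : ∀ a b c d → (a xor b) xor (c xor d) ≡ (a xor c) xor (b xor d)
xor-interchange a b c d = begin
  (a xor b) xor (c xor d)  ≡⟨ xor-assoc a b (c xor d) ⟩
  a xor (b xor (c xor d))  ≡⟨ cong (a xor_) (xor-assoc b c d) ⟨
  a xor ((b xor c) xor d)  ≡⟨ cong (λ x → a xor (x xor d)) (xor-comm b c) ⟩
  a xor ((c xor b) xor d)  ≡⟨ cong (a xor_) (xor-assoc c b d) ⟩
  a xor (c xor (b xor d))  ≡⟨ xor-assoc a c (b xor d) ⟨
  (a xor c) xor (b xor d)  ∎
  where open ≡-Reasoning

⨁-cong : ∀ n {f g} → (∀ i → i < n → f i ≡ g i) → ⨁ n f ≡ ⨁ n g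
⨁-cong zero    e = refl
⨁-cong (suc n) e = cong₂ _xor_ (⨁-cong n λ i i<n → e i (m<n⇒m<1+n i<n)) (e n ≤-refl)

⨁-xor : ∀ n f g → ⨁ n (λ i → f i xor g i) ≡ ⨁ n f xor ⨁ n g
⨁-xor zero    f g = refl
⨁-xor (suc n) f g = trans (cong (_xor (f n xor g n)) (⨁-xor n f g)) (xor-interchange (⨁ n f) (⨁ n g) (f n) (g n))

⨁-false : ∀ n → ⨁ n (λ _ → false) ≡ false
⨁-false zero    = refl
⨁-false (suc n) = trans (xor-identityʳ _) (⨁-false n)

⨁-zero : ∀ n {f} → (∀ i → i < n → f i ≡ false) → ⨁ n f ≡ false
⨁-zero n e = trans (⨁-cong n e) (⨁-false n)

⨁-head : ∀ n f → ⨁ (suc n) f ≡ f 0 xor ⨁ n (f ∘ suc)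
⨁-head zero    f = sym (xor-identityʳ (f 0))
⨁-head (suc n) f = trans (cong (_xor f (suc n)) (⨁-head n f)) (xor-assoc (f 0) _ _)

⨁-split : ∀ a b f → ⨁ (a + b) f ≡ ⨁ a f xor ⨁ b (λ i → f (a + i))
⨁-split a zero    f rewrite +-identityʳ a = sym (xor-identityʳ _)
⨁-split a (suc b) f rewrite +-suc a b =
  trans (cong (_xor f (a + b)) (⨁-split a b f)) (xor-assoc (⨁ a f) _ _)

xor-cancel-middle : ∀ a b c → (a xor b) xor (b xor c) ≡ a xor c
xor-cancel-middle a b c = trans (sym (xor-assoc (a xor b) b c)) (cong (_xor c)
  (trans (xor-assoc a b b) (trans (cong (a xor_) (xor-same b)) (xor-identityʳ a))))

⨁-telescope : ∀ n (f : ℕ → Bool) → ⨁ n (λ i → f i xor f (suc i)) ≡ f 0 xor f n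
⨁-telescope zero    f = sym (xor-same (f 0))
⨁-telescope (suc n) f =
  trans (cong (_xor (f n xor f (suc n))) (⨁-telescope n f)) (xor-cancel-middle (f 0) (f n) (f (suc n)))

⨁-const : ∀ n b → ⨁ (n + n) (λ _ → b) ≡ false
⨁-const n b = trans (⨁-split n n (λ _ → b)) (xor-same (⨁ n (λ _ → b)))

-- Lattice curves.

Pos : Set
Pos = ℕ × ℕ

data Adj : Pos → Pos → Set where
  u⁺ : ∀ {u v} → Adj (u , v) (suc u , v)
  u⁻ : ∀ {u v} → Adj (suc u , v) (u , v)
  v⁺ : ∀ {u v} → Adj (u , v) (u , suc v)
  v⁻ : ∀ {u v} → Adj (u , suc v) (u , v)

above right : Pos → Pos → Bool
above p q = proj₂ p <ᵇ proj₂ q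
right p q = proj₁ p <ᵇ proj₁ q

-- Whether the unit step from q − p to q′ − p, respectively to q − p′, crosses the ray u > 0, v = ½.
cross : Pos → Pos → Pos → Bool
cross p q q′ = (above p q xor above p q′) ∧ right p q

cross′ : Pos → Pos → Pos → Bool
cross′ p p′ q = (above p q xor above p′ q) ∧ right p q

<ᵇ-jumpʳ : ∀ a b → (a <ᵇ b) xor (a <ᵇ suc b) ≡ true → a ≡ b
<ᵇ-jumpʳ zero    zero    _ = refl
<ᵇ-jumpʳ (suc a) (suc b) e = cong suc (<ᵇ-jumpʳ a b e)

<ᵇ-jumpˡ : ∀ a b → (a <ᵇ b) xor (suc a <ᵇ b) ≡ true → suc a ≡ b
<ᵇ-jumpˡ zero    (suc zero) _ = refl
<ᵇ-jumpˡ (suc a) (suc b) e = cong suc (<ᵇ-jumpˡ a b e)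

∧-xor-false : ∀ a b c → (a ≡ true → b xor c ≡ true → ⊥) → (a ∧ b) xor (a ∧ c) ≡ false
∧-xor-false false b     c     _ = refl
∧-xor-false true  false false _ = refl
∧-xor-false true  false true  h = ⊥-elim (h refl refl)
∧-xor-false true  true  false h = ⊥-elim (h refl refl)
∧-xor-false true  true  true  _ = refl

flip-true : ∀ a b → b xor a ≡ true → a xor b ≡ true
flip-true a b = trans (xor-comm a b)

xor-square : ∀ a b c d r →
  ((a xor b) ∧ r) xor ((c xor d) ∧ r) ≡ ((a xor c) ∧ r) xor ((b xor d) ∧ r)
xor-square a b c d false rewrite ∧-zeroʳ (a xor b) | ∧-zeroʳ (c xor d)
                               | ∧-zeroʳ (a xor c) | ∧-zeroʳ (b xor d) = refl
xor-square a b c d true rewrite ∧-identityʳ (a xor b) | ∧-identityʳ (c xor d)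
                              | ∧-identityʳ (a xor c) | ∧-identityʳ (b xor d) = xor-interchange a b c d

-- The plaquette spanned by the steps p → p′ and q → q′ avoids the origin, so its
-- boundary crosses the ray an even number of times.
cell : ∀ {p p′ q q′} → Adj p p′ → Adj q q′ → p ≢ q → p ≢ q′ → p′ ≢ q → p′ ≢ q′ →
  cross p q q′ xor cross p′ q q′ ≡ cross′ p p′ q xor cross′ p p′ q′
cell {p = u , v} {q = a , b} u⁺ u⁺ _ _ _ _ rewrite xor-same (v <ᵇ b) = refl
cell {p = u , v} {q = a , b} u⁺ u⁻ _ _ _ _ rewrite xor-same (v <ᵇ b) = refl
cell {p = u , v} {q = a , b} u⁻ u⁺ _ _ _ _ rewrite xor-same (v <ᵇ b) = refl
cell {p = u , v} {q = a , b} u⁻ u⁻ _ _ _ _ rewrite xor-same (v <ᵇ b) = refl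
cell {p = u , v} {p′ = _ , v′} {q = a , b} {q′ = _ , b′} v⁺ v⁺ _ _ _ _ = xor-square (v <ᵇ b) (v <ᵇ b′) (v′ <ᵇ b) (v′ <ᵇ b′) (u <ᵇ a)
cell {p = u , v} {p′ = _ , v′} {q = a , b} {q′ = _ , b′} v⁺ v⁻ _ _ _ _ = xor-square (v <ᵇ b) (v <ᵇ b′) (v′ <ᵇ b) (v′ <ᵇ b′) (u <ᵇ a)
cell {p = u , v} {p′ = _ , v′} {q = a , b} {q′ = _ , b′} v⁻ v⁺ _ _ _ _ = xor-square (v <ᵇ b) (v <ᵇ b′) (v′ <ᵇ b) (v′ <ᵇ b′) (u <ᵇ a)
cell {p = u , v} {p′ = _ , v′} {q = a , b} {q′ = _ , b′} v⁻ v⁻ _ _ _ _ = xor-square (v <ᵇ b) (v <ᵇ b′) (v′ <ᵇ b) (v′ <ᵇ b′) (u <ᵇ a)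
-- For perpendicular steps the plaquette is a unit square. The ray starts inside the square whose
-- lower left corner is the origin, so each case uses just the inequality for its own lower left
-- corner.
cell {p = u , v} {q = a , b} u⁺ v⁺ pq pq′ p′q p′q′ rewrite xor-same (v <ᵇ b) | xor-same (v <ᵇ suc b) =
  ∧-xor-false _ (u <ᵇ a) (suc u <ᵇ a) λ e e′ → p′q (cong₂ _,_ (<ᵇ-jumpˡ u a e′) (<ᵇ-jumpʳ v b e))
cell {p = u , v} {q = a , suc b} u⁺ v⁻ pq pq′ p′q p′q′ rewrite xor-same (v <ᵇ b) | xor-same (v <ᵇ suc b) =
  ∧-xor-false _ (u <ᵇ a) (suc u <ᵇ a) λ e e′ → p′q′ (cong₂ _,_ (<ᵇ-jumpˡ u a e′) (<ᵇ-jumpʳ v b (flip-true (v <ᵇ b) _ e)))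
cell {p = suc u , v} {q = a , b} u⁻ v⁺ pq pq′ p′q p′q′ rewrite xor-same (v <ᵇ b) | xor-same (v <ᵇ suc b) =
  ∧-xor-false _ (suc u <ᵇ a) (u <ᵇ a) λ e e′ → pq (cong₂ _,_ (<ᵇ-jumpˡ u a (flip-true (u <ᵇ a) _ e′)) (<ᵇ-jumpʳ v b e))
cell {p = suc u , v} {q = a , suc b} u⁻ v⁻ pq pq′ p′q p′q′ rewrite xor-same (v <ᵇ b) | xor-same (v <ᵇ suc b) =
  ∧-xor-false _ (suc u <ᵇ a) (u <ᵇ a) λ e e′ →
    pq′ (cong₂ _,_ (<ᵇ-jumpˡ u a (flip-true (u <ᵇ a) _ e′)) (<ᵇ-jumpʳ v b (flip-true (v <ᵇ b) _ e)))
cell {p = u , v} {q = a , b} v⁺ u⁺ pq pq′ p′q p′q′ rewrite xor-same (v <ᵇ b) | xor-same (suc v <ᵇ b) =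
  sym (∧-xor-false _ (u <ᵇ a) (u <ᵇ suc a) λ e e′ → p′q (cong₂ _,_ (<ᵇ-jumpʳ u a e′) (<ᵇ-jumpˡ v b e)))
cell {p = u , v} {q = suc a , b} v⁺ u⁻ pq pq′ p′q p′q′ rewrite xor-same (v <ᵇ b) | xor-same (suc v <ᵇ b) =
  sym (∧-xor-false _ (u <ᵇ suc a) (u <ᵇ a) λ e e′ → p′q′ (cong₂ _,_ (<ᵇ-jumpʳ u a (flip-true (u <ᵇ a) _ e′)) (<ᵇ-jumpˡ v b e)))
cell {p = u , suc v} {q = a , b} v⁻ u⁺ pq pq′ p′q p′q′ rewrite xor-same (v <ᵇ b) | xor-same (suc v <ᵇ b) =
  sym (∧-xor-false _ (u <ᵇ a) (u <ᵇ suc a) λ e e′ → pq (cong₂ _,_ (<ᵇ-jumpʳ u a e′) (<ᵇ-jumpˡ v b (flip-true (v <ᵇ b) _ e))))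
cell {p = u , suc v} {q = suc a , b} v⁻ u⁻ pq pq′ p′q p′q′ rewrite xor-same (v <ᵇ b) | xor-same (suc v <ᵇ b) =
  sym (∧-xor-false _ (u <ᵇ suc a) (u <ᵇ a) λ e e′ →
    pq′ (cong₂ _,_ (<ᵇ-jumpʳ u a (flip-true (u <ᵇ a) _ e′)) (<ᵇ-jumpˡ v b (flip-true (v <ᵇ b) _ e))))

-- Whether q − p lies on the upper side of the line formed by the ray, the origin and the
-- opposite ray.
upper : Pos → Pos → Bool
upper p q = above p q ∨ ((proj₂ p ≡ᵇ proj₂ q) ∧ right q p)

upper-horizontal : ∀ {u v a b} → (a , b) ≢ (u , v) → upper (u , v) (a , b) ≡ upper (suc u , v) (a , b)
upper-horizontal {u} {v} {a} {b} ne with v <ᵇ b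
... | true  = refl
... | false with v ≡ᵇ b in e
...   | false = refl
...   | true with a <ᵇ u in e₁ | a <ᵇ suc u in e₂
...     | false | false = refl
...     | true  | true  = refl
...     | false | true  = ⊥-elim (ne (cong₂ _,_ (<ᵇ-jumpʳ a u (cong₂ _xor_ e₁ e₂)) (sym (≡ᵇ-true⁻ v b e))))
...     | true  | false = ⊥-elim (ne (cong₂ _,_ (<ᵇ-jumpʳ a u (cong₂ _xor_ e₁ e₂)) (sym (≡ᵇ-true⁻ v b e))))

<ᵇ-flip : ∀ a u → a ≢ u → (u <ᵇ a) ≡ not (a <ᵇ u)
<ᵇ-flip zero    zero    ne = contradiction refl ne
<ᵇ-flip zero    (suc u) ne = refl
<ᵇ-flip (suc a) zero    ne = refl
<ᵇ-flip (suc a) (suc u) ne = <ᵇ-flip a u (ne ∘ cong suc)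

turn-vertical : ∀ u v a b → (a , b) ≢ (u , suc v) →
  cross (a , b) (u , v) (u , suc v) xor cross′ (u , v) (u , suc v) (a , b)
    ≡ upper (u , v) (a , b) xor upper (u , suc v) (a , b)
turn-vertical u (suc v) a (suc b) ne = turn-vertical u v a b λ { refl → ne refl }
turn-vertical u zero    a zero    ne = refl
turn-vertical u zero    a (suc zero) ne = <ᵇ-flip a u λ { refl → ne refl }
turn-vertical u zero    a (suc (suc b)) ne = refl
turn-vertical u (suc v) a zero    ne = refl

-- Seen from `q − p`, the term `cross q p p′` is a crossing of the opposite ray. The two rays and
-- the origin bound the upper side, so a step that avoids the origin changes sides exactly when it
-- crosses one of them.
turn : ∀ {p p′ q} → Adj p p′ → q ≢ p → q ≢ p′ →
  cross q p p′ xor cross′ p p′ q ≡ upper p q xor upper p′ q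
turn {p = u , v} {q = a , b} u⁺ qp _ rewrite xor-same (b <ᵇ v) | xor-same (v <ᵇ b) | upper-horizontal qp =
  sym (xor-same (upper (suc u , v) (a , b)))
turn {p = suc u , v} {q = a , b} u⁻ _ qp′ rewrite xor-same (b <ᵇ v) | xor-same (v <ᵇ b) | sym (upper-horizontal qp′) =
  sym (xor-same (upper (u , v) (a , b)))
turn {p = u , v} {q = a , b} v⁺ _ qp′ = turn-vertical u v a b qp′
turn {p = u , suc v} {q = a , b} v⁻ qp _
  rewrite xor-comm (b <ᵇ suc v) (b <ᵇ v) | xor-comm (suc v <ᵇ b) (v <ᵇ b) =
  trans (turn-vertical u v a b qp) (xor-comm (upper (u , v) (a , b)) _)

cross-start : ∀ {q q′} → Adj q q′ → cross q q q′ ≡ false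
cross-start {u , v} _ rewrite <ᵇ-false {u} ≤-refl = ∧-zeroʳ _

cross-end : ∀ {q q′} → Adj q q′ → cross q′ q q′ ≡ false
cross-end {q = u , v} u⁺ rewrite xor-same (v <ᵇ v) = refl
cross-end {q = suc u , v} u⁻ rewrite xor-same (v <ᵇ v) = refl
cross-end {q = u , v} v⁺ rewrite <ᵇ-false {u} ≤-refl = ∧-zeroʳ _
cross-end {q = u , suc v} v⁻ rewrite <ᵇ-false {u} ≤-refl = ∧-zeroʳ _

upper⇒¬above : ∀ {p q} → upper q p ≡ true → above p q ≡ false
upper⇒¬above {u , v} {a , b} e with b <ᵇ v in lt
... | true  = <ᵇ-false (<⇒≤ (<ᵇ-true⁻ b v lt))
... | false with b ≡ᵇ v in eq
...   | true rewrite ≡ᵇ-true⁻ b v eq = <ᵇ-false {v} ≤-refl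

upper-edge : ∀ u v a → upper (u , v) (a , v) ≡ true → right (u , v) (a , v) ≡ false
upper-edge u v a e rewrite <ᵇ-false {v} ≤-refl | ≡ᵇ-refl v = <ᵇ-false (<⇒≤ (<ᵇ-true⁻ a u e))

cross-upper : ∀ {p q q′} → Adj q q′ → upper p q ≡ true → upper p q′ ≡ true → cross p q q′ ≡ false
cross-upper {u , v} {a , b} u⁺ _ _ rewrite xor-same (v <ᵇ b) = refl
cross-upper {u , v} {a , b} u⁻ _ _ rewrite xor-same (v <ᵇ b) = refl
cross-upper {u , v} {a , b} v⁺ e e′ with (v <ᵇ b) xor (v <ᵇ suc b) in jump
... | false = refl
... | true with refl ← <ᵇ-jumpʳ v b jump = upper-edge u v a e
cross-upper {u , v} {a , suc b} v⁻ e e′ with (v <ᵇ suc b) xor (v <ᵇ b) in jump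
... | false = refl
... | true with refl ← <ᵇ-jumpʳ v b (flip-true (v <ᵇ b) (v <ᵇ suc b) jump) = upper-edge u v a e′

xor-move : ∀ a b {c} → a xor b ≡ c → a ≡ b xor c
xor-move false false refl = refl
xor-move false true  refl = refl
xor-move true  false refl = refl
xor-move true  true  refl = refl

-- Hopf's argument: winding numbers around the points of a simple closed curve

module ClosedCurve
  (N : ℕ) (γ : ℕ → Pos)
  (adj : ∀ s → Adj (γ s) (γ (suc s)))
  (closed : γ (2 + N) ≡ γ 0)
  (inj : ∀ s t → s < t → t < 2 + N → γ s ≢ γ t)
  (extreme : ∀ t → 0 < t → t < 2 + N → upper (γ 0) (γ t) ≡ true)
  where

  -- All three concern a difference of two curve points, viewed as a function of a pair of indices.
  -- `X s t` is a crossing while the target advances from `t`, `Z t s` a crossing while the base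
  -- advances from `t`, and `Y t s` the side of the line on which the difference lies.
  X Z Y : ℕ → ℕ → Bool
  X s t = cross (γ s) (γ t) (γ (suc t))
  Z t s = cross′ (γ t) (γ (suc t)) (γ s)
  Y t s = upper (γ t) (γ s)

  inj′ : ∀ s t → 0 < s → s < t → t ≤ 2 + N → γ s ≢ γ t
  inj′ s t 0<s s<t t≤ e with m≤n⇒m<n∨m≡n t≤
  ... | inj₁ t<   = inj s t s<t t< e
  ... | inj₂ refl = inj 0 s 0<s s<t (sym (trans e closed))

  -- The rest of the curve stays on the upper side of the base point, so its steps cannot cross the
  -- ray; the two steps at the base point itself do not cross it either.
  X-base : ∀ t → t < 2 + N → X 0 t ≡ false
  X-base zero    _  = cross-start (adj 0)
  X-base (suc t) t< with m≤n⇒m<n∨m≡n t<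
  ... | inj₁ t<′  = cross-upper (adj (suc t)) (extreme (suc t) z<s t<) (extreme (2 + t) z<s t<′)
  ... | inj₂ refl = subst (λ q → cross q (γ (suc N)) (γ (2 + N)) ≡ false) closed (cross-end (adj (suc N)))

  ¬above-base : ∀ t → 0 < t → t < 2 + N → above (γ t) (γ (2 + N)) ≡ false
  ¬above-base t 0<t t< rewrite closed = upper⇒¬above {γ t} {γ 0} (extreme t 0<t t<)

  Z-base : ∀ s → 0 < s → suc s < 2 + N → Z s (2 + N) ≡ false
  Z-base s 0<s s< rewrite ¬above-base s 0<s (<-trans ≤-refl s<) | ¬above-base (suc s) z<s s< = refl

  A : ℕ → ℕ → Bool
  A s r = ⨁ r (λ i → X (suc s) (2 + (s + i)))

  K : ℕ → Bool
  K s = ⨁ s (λ t → Z t (suc s))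

  -- For `t < s`, `turn` trades a crossing with target moving for one with base moving, so the pair
  -- of indices is reflected across the diagonal. The sides `Y` telescope, and `Y 0 (suc s)` is
  -- `true` by extremality, which gives the `not`. The two steps at `γ (suc s)` itself do not cross;
  -- the remaining `r` steps are `A s r`.
  row : ∀ s r → s + r ≡ N → ⨁ (2 + N) (X (suc s)) ≡ (A s r xor K s) xor not (Y s (suc s))
  row s r refl = begin
    ⨁ (2 + (s + r)) f
      ≡⟨ cong (λ n → ⨁ n f) (trans (cong suc (sym (+-suc s r))) (sym (+-suc s (suc r)))) ⟩
    ⨁ (s + (2 + r)) f
      ≡⟨ ⨁-split s (2 + r) f ⟩
    ⨁ s f xor ⨁ (2 + r) (λ i → f (s + i))
      ≡⟨ cong₂ _xor_ left (trans (⨁-head (suc r) _) (cong₂ _xor_ s₀ (trans (⨁-head r _) (cong₂ _xor_ s₁ rest)))) ⟩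
    (K s xor not (Y s (suc s))) xor A s r
      ≡⟨ xor-comm _ (A s r) ⟩
    A s r xor (K s xor not (Y s (suc s)))
      ≡⟨ xor-assoc (A s r) _ _ ⟨
    (A s r xor K s) xor not (Y s (suc s)) ∎
    where
    open ≡-Reasoning
    f : ℕ → Bool
    f = X (suc s)
    s< : suc s < 2 + (s + r)
    s< = s≤s (s≤s (m≤m+n s r))
    left : ⨁ s f ≡ K s xor not (Y s (suc s))
    left = begin
      ⨁ s f
        ≡⟨ ⨁-cong s (λ t t<s → xor-move (X (suc s) t) (Z t (suc s)) (turn (adj t)
             (λ e → inj t (suc s) (m<n⇒m<1+n t<s) s< (sym e))
             (λ e → inj (suc t) (suc s) (s≤s t<s) s< (sym e)))) ⟩
      ⨁ s (λ t → Z t (suc s) xor (Y t (suc s) xor Y (suc t) (suc s)))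
        ≡⟨ ⨁-xor s _ _ ⟩
      K s xor ⨁ s (λ t → Y t (suc s) xor Y (suc t) (suc s))
        ≡⟨ cong (K s xor_) (⨁-telescope s (λ t → Y t (suc s))) ⟩
      K s xor (Y 0 (suc s) xor Y s (suc s))
        ≡⟨ cong (λ b → K s xor (b xor Y s (suc s))) (extreme (suc s) z<s s<) ⟩
      K s xor not (Y s (suc s)) ∎
    s₀ : f (s + 0) ≡ false
    s₀ rewrite +-identityʳ s = cross-end (adj s)
    s₁ : f (s + 1) ≡ false
    s₁ rewrite +-comm s 1 = cross-start (adj (suc s))
    rest : ⨁ r (λ i → f (s + (2 + i))) ≡ A s r
    rest = ⨁-cong r λ i _ → cong f (trans (+-suc s (suc i)) (cong suc (+-suc s i)))

  -- A s r xor K (suc s) counts the crossings along a path in the triangle of pairs of indices;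
  -- the strip between consecutive paths consists of cells, and its outer sides do not cross the ray.
  A+K-step : ∀ s r → s + suc r ≡ N → suc s + r ≡ N → 0 < r →
    A s (suc r) xor K (suc s) ≡ A (suc s) r xor K (2 + s)
  A+K-step s zero _ _ ()
  A+K-step s (suc r) e refl _ = begin
    A s (2 + r) xor K (suc s)
      ≡⟨ cong₂ _xor_ A-strip K-strip ⟩
    (x xor (A (suc s) (suc r) xor z)) xor (K′ xor x)
      ≡⟨ cong (_xor (K′ xor x)) (xor-comm x _) ⟩
    ((A (suc s) (suc r) xor z) xor x) xor (K′ xor x)
      ≡⟨ cong (((A (suc s) (suc r) xor z) xor x) xor_) (xor-comm K′ x) ⟩
    ((A (suc s) (suc r) xor z) xor x) xor (x xor K′)
      ≡⟨ xor-cancel-middle (A (suc s) (suc r) xor z) x K′ ⟩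
    (A (suc s) (suc r) xor z) xor K′
      ≡⟨ trans (xor-assoc (A (suc s) (suc r)) z K′) (cong (A (suc s) (suc r) xor_) (xor-comm z K′)) ⟩
    A (suc s) (suc r) xor K (2 + s) ∎
    where
    open ≡-Reasoning
    -- The square of pairs with first index `suc s` or `2 + s` and second index `2 + s` or `3 + s`
    -- touches the diagonal, where the difference is zero and `cell` does not apply. Its two other
    -- sides `x` and `z` are carried along instead: `x` appears in both strips and cancels, `z`
    -- completes `K′` to `K (2 + s)`.
    x z K′ : Bool
    x = X (suc s) (2 + s)
    z = Z (suc s) (3 + s)
    K′ = ⨁ (suc s) (λ t → Z t (3 + s))
    s<N : suc s < N
    s<N = s≤s (m<m+n s z<s)
    A-strip : A s (2 + r) ≡ x xor (A (suc s) (suc r) xor z)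
    A-strip = begin
      A s (2 + r)
        ≡⟨ ⨁-head (suc r) _ ⟩
      X (suc s) (2 + (s + 0)) xor ⨁ (suc r) (λ i → X (suc s) (2 + (s + suc i)))
        ≡⟨ cong₂ _xor_ (cong (λ n → X (suc s) (2 + n)) (+-identityʳ s))
             (⨁-cong (suc r) λ i i< → trans (cong (λ n → X (suc s) (2 + n)) (+-suc s i)) (strip-cell i i<)) ⟩
      x xor ⨁ (suc r) (λ i → X (2 + s) (3 + (s + i)) xor (Z (suc s) (3 + (s + i)) xor Z (suc s) (4 + (s + i))))
        ≡⟨ cong (x xor_) (⨁-xor (suc r) _ _) ⟩
      x xor (A (suc s) (suc r) xor ⨁ (suc r) (λ i → Z (suc s) (3 + (s + i)) xor Z (suc s) (4 + (s + i))))
        ≡⟨ cong (λ b → x xor (A (suc s) (suc r) xor b)) (trans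
             (⨁-cong (suc r) λ i _ → cong (λ n → Z (suc s) (3 + (s + i)) xor Z (suc s) (3 + n)) (sym (+-suc s i)))
             (⨁-telescope (suc r) (λ i → Z (suc s) (3 + (s + i))))) ⟩
      x xor (A (suc s) (suc r) xor (Z (suc s) (3 + (s + 0)) xor Z (suc s) (2 + N)))
        ≡⟨ cong (λ b → x xor (A (suc s) (suc r) xor b)) (trans
             (cong₂ _xor_ (cong (λ n → Z (suc s) (3 + n)) (+-identityʳ s))
               (Z-base (suc s) z<s (s≤s (s≤s (<⇒≤ s<N)))))
             (xor-identityʳ _)) ⟩
      x xor (A (suc s) (suc r) xor z) ∎
      where
      strip-cell : ∀ i → i < suc r → X (suc s) (3 + (s + i)) ≡
        X (2 + s) (3 + (s + i)) xor (Z (suc s) (3 + (s + i)) xor Z (suc s) (4 + (s + i)))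
      strip-cell i i<r = xor-move (X (suc s) (3 + (s + i))) (X (2 + s) (3 + (s + i)))
        (cell (adj (suc s)) (adj (3 + (s + i)))
          (inj′ _ _ z<s (m<n⇒m<1+n t₀) (<⇒≤ t₁)) (inj′ _ _ z<s (m<n⇒m<1+n (m<n⇒m<1+n t₀)) t₁)
          (inj′ _ _ z<s (s≤s t₀) (<⇒≤ t₁)) (inj′ _ _ z<s (m<n⇒m<1+n (s≤s t₀)) t₁))
        where
        t₀ : suc s < 2 + (s + i)
        t₀ = s≤s (s≤s (m≤m+n s i))
        t₁ : 3 + (s + i) < 2 + N
        t₁ = s≤s (s≤s (s≤s (+-monoʳ-< s i<r)))
    K-strip : K (suc s) ≡ K′ xor x
    K-strip = begin
      ⨁ (suc s) (λ t → Z t (2 + s))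
        ≡⟨ ⨁-cong (suc s) (λ t t< → xor-move (Z t (2 + s)) (Z t (3 + s)) (sym
             (cell (adj t) (adj (2 + s))
               (inj _ _ (m<n⇒m<1+n t<) t₀) (inj _ _ (m<n⇒m<1+n (m<n⇒m<1+n t<)) t₁)
               (inj _ _ (s≤s t<) t₀) (inj _ _ (m<n⇒m<1+n (s≤s t<)) t₁)))) ⟩
      ⨁ (suc s) (λ t → Z t (3 + s) xor (X t (2 + s) xor X (suc t) (2 + s)))
        ≡⟨ ⨁-xor (suc s) _ _ ⟩
      K′ xor ⨁ (suc s) (λ t → X t (2 + s) xor X (suc t) (2 + s))
        ≡⟨ cong (K′ xor_) (⨁-telescope (suc s) (λ t → X t (2 + s))) ⟩
      K′ xor (X 0 (2 + s) xor x)
        ≡⟨ cong (λ b → K′ xor (b xor x)) (X-base (2 + s) t₀) ⟩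
      K′ xor x ∎
      where
      t₁ : 3 + s < 2 + N
      t₁ = s≤s (s≤s s<N)
      t₀ : 2 + s < 2 + N
      t₀ = <-trans ≤-refl t₁

  A+K-const : ∀ s r → s + suc r ≡ N → A s (suc r) xor K (suc s) ≡ A 0 N xor K 1
  A+K-const zero    r refl = refl
  A+K-const (suc s) r e = trans (sym (A+K-step s (suc r) e′ e z<s)) (A+K-const s (suc r) e′)
    where
    e′ : s + (2 + r) ≡ N
    e′ = trans (+-suc s (suc r)) e

  -- `A N` and `K 0` are empty sums, so `A s` can be paired with `K (suc s)`. The `N` pairs share
  -- one value, and whatever it is they cancel because `N` is even. What is left is an odd number,
  -- `N + 1`, of negated sides.
  self-crossings : (h : ℕ) → N ≡ h + h →
    ⨁ (2 + N) (λ s → ⨁ (2 + N) (X s)) ≡ not (⨁ (suc N) (λ s → Y s (suc s)))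
  self-crossings h even = begin
    ⨁ (2 + N) (λ s → ⨁ (2 + N) (X s))
      ≡⟨ ⨁-head (suc N) _ ⟩
    ⨁ (2 + N) (X 0) xor ⨁ (suc N) (λ s → ⨁ (2 + N) (X (suc s)))
      ≡⟨ cong₂ _xor_ (⨁-zero (2 + N) X-base)
           (⨁-cong (suc N) λ s s< → row s (N ∸ s) (m+[n∸m]≡n (s≤s⁻¹ s<))) ⟩
    ⨁ (suc N) (λ s → (A s (N ∸ s) xor K s) xor not (Y s (suc s)))
      ≡⟨ ⨁-xor (suc N) _ _ ⟩
    ⨁ (suc N) (λ s → A s (N ∸ s) xor K s) xor ⨁ (suc N) (λ s → not (Y s (suc s)))
      ≡⟨ cong₂ _xor_ A+K (⨁-xor (suc N) (λ _ → true) _) ⟩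
    (⨁ N (λ _ → true) xor true) xor ⨁ (suc N) (λ s → Y s (suc s))
      ≡⟨ cong (λ b → (b xor true) xor ⨁ (suc N) (λ s → Y s (suc s))) (const true) ⟩
    not (⨁ (suc N) (λ s → Y s (suc s))) ∎
    where
    open ≡-Reasoning
    const : ∀ b → ⨁ N (λ _ → b) ≡ false
    const b rewrite even = ⨁-const h b
    A+K : ⨁ (suc N) (λ s → A s (N ∸ s) xor K s) ≡ false
    A+K = begin
      ⨁ (suc N) (λ s → A s (N ∸ s) xor K s)
        ≡⟨ ⨁-xor (suc N) _ _ ⟩
      (⨁ N (λ s → A s (N ∸ s)) xor A N (N ∸ N)) xor ⨁ (suc N) K
        ≡⟨ cong₂ _xor_ (trans (cong (λ n → ⨁ N (λ s → A s (N ∸ s)) xor A N n) (n∸n≡0 N)) (xor-identityʳ (⨁ N (λ s → A s (N ∸ s))))) (⨁-head N K) ⟩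
      ⨁ N (λ s → A s (N ∸ s)) xor ⨁ N (λ s → K (suc s))
        ≡⟨ ⨁-xor N _ _ ⟨
      ⨁ N (λ s → A s (N ∸ s) xor K (suc s))
        ≡⟨ ⨁-cong N (λ s s< → step s (N ∸ s) (m<n⇒0<n∸m s<) (m+[n∸m]≡n (<⇒≤ s<))) ⟩
      ⨁ N (λ _ → A 0 N xor K 1)
        ≡⟨ const _ ⟩
      false ∎
      where
      step : ∀ s r → 0 < r → s + r ≡ N → A s r xor K (suc s) ≡ A 0 N xor K 1
      step s (suc r) _ e = A+K-const s r e

-- Winding numbers mod 2 around points off the curve

winding : ℕ → (ℕ → Pos) → Pos → Bool
winding L γ p = ⨁ L (λ s → cross p (γ s) (γ (suc s)))

-- The move from `p` to `p′` spans a plaquette with each step of the curve; the lateral terms of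
-- `cell` telescope around the closed curve.
winding-adj : ∀ L γ → (∀ s → Adj (γ s) (γ (suc s))) → γ L ≡ γ 0 →
  ∀ {p p′} → Adj p p′ → (∀ s → s ≤ L → p ≢ γ s) → (∀ s → s ≤ L → p′ ≢ γ s) →
  winding L γ p ≡ winding L γ p′
winding-adj L γ adj closed {p} {p′} step off off′ = begin
  winding L γ p
    ≡⟨ ⨁-cong L (λ s s< → xor-move (cross p (γ s) (γ (suc s))) (cross p′ (γ s) (γ (suc s)))
         (cell step (adj s) (off s (<⇒≤ s<)) (off (suc s) s<) (off′ s (<⇒≤ s<)) (off′ (suc s) s<))) ⟩
  ⨁ L (λ s → cross p′ (γ s) (γ (suc s)) xor (f s xor f (suc s)))
    ≡⟨ ⨁-xor L _ _ ⟩
  winding L γ p′ xor ⨁ L (λ s → f s xor f (suc s))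
    ≡⟨ cong (winding L γ p′ xor_) (⨁-telescope L f) ⟩
  winding L γ p′ xor (f 0 xor f L)
    ≡⟨ cong (λ q → winding L γ p′ xor (f 0 xor cross′ p p′ q)) closed ⟩
  winding L γ p′ xor (f 0 xor f 0)
    ≡⟨ trans (cong (winding L γ p′ xor_) (xor-same (f 0))) (xor-identityʳ _) ⟩
  winding L γ p′ ∎
  where
  open ≡-Reasoning
  f : ℕ → Bool
  f s = cross′ p p′ (γ s)

⨁-pairs : ∀ d f → ⨁ (d + d) f ≡ ⨁ d (λ i → f (i + i) xor f (suc (i + i)))
⨁-pairs zero    f = refl
⨁-pairs (suc d) f rewrite +-suc d d =
  trans (xor-assoc (⨁ (d + d) f) _ _) (cong (_xor (f (d + d) xor f (suc (d + d)))) (⨁-pairs d f))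

-- The base point: lowest, and rightmost among the lowest

upper-asym : ∀ p q → upper p q ≡ true → upper q p ≡ false
upper-asym (u , v) (a , b) e with <-cmp v b
... | tri< v<b v≢b _ rewrite <ᵇ-false (<⇒≤ v<b) with b ≡ᵇ v in eq
...   | true  = contradiction (sym (≡ᵇ-true⁻ b v eq)) v≢b
...   | false = refl
upper-asym (u , v) (a , b) e | tri≈ _ refl _ rewrite <ᵇ-false {v} ≤-refl | ≡ᵇ-refl v = <ᵇ-false (<⇒≤ (<ᵇ-true⁻ a u e))
upper-asym (u , v) (a , b) e | tri> _ v≢b b<v rewrite <ᵇ-false (<⇒≤ b<v) with v ≡ᵇ b in eq
...   | true  = contradiction (≡ᵇ-true⁻ v b eq) v≢b
upper-asym (u , v) (a , b) () | tri> _ v≢b b<v | false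

-- Height is compared first, and within a row the point further right is smaller. This is the order
-- for which a minimum has all other points on its `upper` side.
record _≼_ (p q : Pos) : Set where
  constructor lex
  field
    low  : proj₂ p ≤ proj₂ q
    left : proj₂ p ≡ proj₂ q → proj₁ q ≤ proj₁ p

≼-total : ∀ p q → p ≼ q ⊎ q ≼ p
≼-total (u , v) (a , b) with <-cmp v b
... | tri< v<b v≢b _ = inj₁ (lex (<⇒≤ v<b) λ e → contradiction e v≢b)
... | tri> _ v≢b b<v = inj₂ (lex (<⇒≤ b<v) λ e → contradiction (sym e) v≢b)
... | tri≈ _ refl _ with ≤-total u a
...   | inj₁ u≤a = inj₂ (lex ≤-refl λ _ → u≤a)
...   | inj₂ a≤u = inj₁ (lex ≤-refl λ _ → a≤u)

≼-refl : ∀ {p} → p ≼ p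
≼-refl = lex ≤-refl λ _ → ≤-refl

≼-trans : ∀ {p q r} → p ≼ q → q ≼ r → p ≼ r
≼-trans (lex l₁ r₁) (lex l₂ r₂) = lex (≤-trans l₁ l₂) λ { refl →
  ≤-trans (r₂ (≤-antisym l₂ l₁)) (r₁ (≤-antisym l₁ l₂)) }

≼⇒upper : ∀ {p q} → p ≼ q → p ≢ q → upper p q ≡ true
≼⇒upper {u , v} {a , b} (lex low left) ne with m≤n⇒m<n∨m≡n low
... | inj₁ v<b rewrite <ᵇ-true v<b = refl
... | inj₂ refl rewrite <ᵇ-false {v} ≤-refl | ≡ᵇ-refl v = <ᵇ-true (≤∧≢⇒< (left refl) λ { refl → ne refl })

≼-minimum : ∀ (f : ℕ → Pos) d → ∃ λ i → ∀ j → j ≤ d → f i ≼ f j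
≼-minimum f zero = 0 , λ { .0 z≤n → ≼-refl }
≼-minimum f (suc d) with ≼-minimum f d
... | i , min with ≼-total (f i) (f (suc d))
...   | inj₁ i≼ = i , λ j j≤ → go j (m≤n⇒m<n∨m≡n j≤)
  where
  go : ∀ j → j < suc d ⊎ j ≡ suc d → f i ≼ f j
  go j (inj₁ (s≤s j≤)) = min j j≤
  go j (inj₂ refl)     = i≼
...   | inj₂ ≼i = suc d , λ j j≤ → go j (m≤n⇒m<n∨m≡n j≤)
  where
  go : ∀ j → j < suc d ⊎ j ≡ suc d → f (suc d) ≼ f j
  go j (inj₁ (s≤s j≤)) = ≼-trans ≼i (min j j≤)
  go j (inj₂ refl)     = ≼-refl

-- Finite enumerations and sums in a commutative monoid

record Enumeration (A : Set) : Set where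
  field
    elements : List A
    unique   : Unique elements
    complete : ∀ x → x ∈ elements

module Sums {R : Set} (_∙_ : R → R → R) (ε : R)
  (assoc : ∀ x y z → (x ∙ y) ∙ z ≡ x ∙ (y ∙ z)) (comm : ∀ x y → x ∙ y ≡ y ∙ x) (idˡ : ∀ x → ε ∙ x ≡ x)
  where

  private variable
    A B : Set

  idʳ : ∀ x → x ∙ ε ≡ x
  idʳ x = trans (comm x ε) (idˡ x)

  ∑ : List A → (A → R) → R
  ∑ []       f = ε
  ∑ (x ∷ xs) f = f x ∙ ∑ xs f

  ∑-cong : ∀ (xs : List A) {f g} → (∀ x → f x ≡ g x) → ∑ xs f ≡ ∑ xs g
  ∑-cong []       e = refl
  ∑-cong (x ∷ xs) e = cong₂ _∙_ (e x) (∑-cong xs e)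

  ∑-zero : ∀ (xs : List A) {f} → (∀ x → x ∈ xs → f x ≡ ε) → ∑ xs f ≡ ε
  ∑-zero []       e = refl
  ∑-zero (x ∷ xs) e = trans (cong₂ _∙_ (e x (here refl)) (∑-zero xs (λ y → e y ∘ there))) (idˡ ε)

  ∑-∙ : ∀ (xs : List A) f g → ∑ xs (λ x → f x ∙ g x) ≡ ∑ xs f ∙ ∑ xs g
  ∑-∙ []       f g = sym (idˡ ε)
  ∑-∙ (x ∷ xs) f g = begin
    (f x ∙ g x) ∙ ∑ xs (λ x → f x ∙ g x)  ≡⟨ cong ((f x ∙ g x) ∙_) (∑-∙ xs f g) ⟩
    (f x ∙ g x) ∙ (F ∙ G)                 ≡⟨ assoc (f x) (g x) (F ∙ G) ⟩
    f x ∙ (g x ∙ (F ∙ G))                 ≡⟨ cong (f x ∙_) (assoc (g x) F G) ⟨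
    f x ∙ ((g x ∙ F) ∙ G)                 ≡⟨ cong (λ z → f x ∙ (z ∙ G)) (comm (g x) F) ⟩
    f x ∙ ((F ∙ g x) ∙ G)                 ≡⟨ cong (f x ∙_) (assoc F (g x) G) ⟩
    f x ∙ (F ∙ (g x ∙ G))                 ≡⟨ assoc (f x) F (g x ∙ G) ⟨
    (f x ∙ F) ∙ (g x ∙ G)                 ∎
    where
    open ≡-Reasoning
    F G : R
    F = ∑ xs f
    G = ∑ xs g

  ∑-comm : ∀ (xs : List A) (ys : List B) (f : A → B → R) → ∑ xs (λ x → ∑ ys (f x)) ≡ ∑ ys (λ y → ∑ xs (λ x → f x y))
  ∑-comm []       ys f = sym (∑-zero ys λ _ _ → refl)
  ∑-comm (x ∷ xs) ys f = trans (cong (∑ ys (f x) ∙_) (∑-comm xs ys f)) (sym (∑-∙ ys (f x) _))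

  ∑-++ : ∀ (xs ys : List A) f → ∑ (xs ++ ys) f ≡ ∑ xs f ∙ ∑ ys f
  ∑-++ []       ys f = sym (idˡ _)
  ∑-++ (x ∷ xs) ys f = trans (cong (f x ∙_) (∑-++ xs ys f)) (sym (assoc (f x) _ _))

  ∑-map : ∀ (h : A → B) xs f → ∑ (map h xs) f ≡ ∑ xs (f ∘ h)
  ∑-map h []       f = refl
  ∑-map h (x ∷ xs) f = cong (f (h x) ∙_) (∑-map h xs f)

  ∑-× : ∀ (xs : List A) (ys : List B) f → ∑ (cartesianProduct xs ys) f ≡ ∑ xs (λ x → ∑ ys (λ y → f (x , y)))
  ∑-× []       ys f = refl
  ∑-× (x ∷ xs) ys f = trans (∑-++ (map (x ,_) ys) _ f) (cong₂ _∙_ (∑-map (x ,_) ys f) (∑-× xs ys f))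

  ∑-tabulate : ∀ {n} (h : Fin n → A) f → ∑ (tabulate h) f ≡ ∑ (allFin n) (f ∘ h)
  ∑-tabulate {n = zero}  h f = refl
  ∑-tabulate {n = suc n} h f = cong (f (h zero) ∙_)
    (trans (∑-tabulate (h ∘ suc) f) (sym (∑-tabulate suc (f ∘ h))))

  ∑-last : ∀ n f → ∑ (allFin (suc n)) f ≡ ∑ (allFin n) (f ∘ inject₁) ∙ f (fromℕ n)
  ∑-last zero    f = comm (f zero) ε
  ∑-last (suc n) f = begin
    f zero ∙ ∑ (tabulate suc) f
      ≡⟨ cong (f zero ∙_) (trans (∑-tabulate suc f) (∑-last n (f ∘ suc))) ⟩
    f zero ∙ (∑ (allFin n) (f ∘ suc ∘ inject₁) ∙ f (fromℕ (suc n)))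
      ≡⟨ assoc (f zero) _ _ ⟨
    (f zero ∙ ∑ (allFin n) (f ∘ suc ∘ inject₁)) ∙ f (fromℕ (suc n))
      ≡⟨ cong (λ z → (f zero ∙ z) ∙ f (fromℕ (suc n))) (∑-tabulate suc (f ∘ inject₁)) ⟨
    ∑ (allFin (suc n)) (f ∘ inject₁) ∙ f (fromℕ (suc n)) ∎
    where open ≡-Reasoning

  ∑-single : ∀ {xs : List A} {a} → Unique xs → a ∈ xs → ∀ f → (∀ x → x ≢ a → f x ≡ ε) → ∑ xs f ≡ f a
  ∑-single {xs = a ∷ xs} uniq@(_ ∷ _) (here refl) f e =
    trans (cong (f a ∙_) (∑-zero xs λ x x∈ → e x λ { refl → Unique[x∷xs]⇒x∉xs uniq x∈ })) (idʳ (f a))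
  ∑-single {xs = x ∷ xs} uniq@(_ ∷ u) (there a∈) f e =
    trans (cong₂ _∙_ (e x λ { refl → Unique[x∷xs]⇒x∉xs uniq a∈ }) (∑-single u a∈ f e)) (idˡ _)

  module _ (_≟_ : DecidableEquality A) where

    δ : A → R → A → R
    δ a r x = if does (x ≟ a) then r else ε

    δ-same : ∀ a r → δ a r a ≡ r
    δ-same a r with a ≟ a
    ... | yes _ = refl
    ... | no ¬e = contradiction refl ¬e

    δ-diff : ∀ a r x → x ≢ a → δ a r x ≡ ε
    δ-diff a r x x≢a with x ≟ a
    ... | yes e = contradiction e x≢a
    ... | no _  = refl

    ∑-δ : (𝔸 : Enumeration A) → ∀ a (g : A → R) → ∑ (Enumeration.elements 𝔸) (λ x → δ a (g x) x) ≡ g a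
    ∑-δ 𝔸 a g = trans (∑-single unique (complete a) (λ x → δ a (g x) x) (λ x → δ-diff a (g x) x)) (δ-same a (g a))
      where open Enumeration 𝔸

    ∑-if : ∀ {B : Set} (xs : List B) b f → ∑ xs (λ x → if b then f x else ε) ≡ (if b then ∑ xs f else ε)
    ∑-if xs true  f = refl
    ∑-if xs false f = ∑-zero xs λ _ _ → refl

    -- The incidences are summed in both orders. With `ends` listing all vertices of an edge this
    -- describes a perfect matching; with `ends` listing lattice points only, a selection of edges
    -- that matches the lattice points.
    double-counting : (𝔸 : Enumeration A) (𝔹 : Enumeration B) (M : B → Bool) (ends : B → List A) →
      (∀ y → Unique (ends y)) →
      (∀ x → ∃ λ y → (M y ≡ true × x ∈ ends y) × (∀ {y′} → M y′ ≡ true × x ∈ ends y′ → y ≡ y′)) →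
      ∀ g → ∑ (Enumeration.elements 𝔸) g ≡ ∑ (Enumeration.elements 𝔹) (λ y → if M y then ∑ (ends y) g else ε)
    double-counting 𝔸 𝔹 M ends uniq matched g = sym (begin
      ∑ ys (λ y → if M y then ∑ (ends y) g else ε)
        ≡⟨ ∑-cong ys (λ y → cong (if M y then_else ε) (trans
             (∑-cong (ends y) λ a → sym (∑-δ 𝔸 a g)) (∑-comm (ends y) xs _))) ⟩
      ∑ ys (λ y → if M y then ∑ xs (λ x → inc x y) else ε)
        ≡⟨ ∑-cong ys (λ y → ∑-if xs (M y) (λ x → inc x y)) ⟨
      ∑ ys (λ y → ∑ xs (λ x → if M y then inc x y else ε))
        ≡⟨ ∑-comm ys xs _ ⟩
      ∑ xs (λ x → ∑ ys (λ y → if M y then inc x y else ε))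
        ≡⟨ ∑-cong xs (λ x → degree x (matched x)) ⟩
      ∑ xs g ∎)
      where
      open ≡-Reasoning
      open Enumeration 𝔸 renaming (elements to xs)
      open Enumeration 𝔹 renaming (elements to ys; unique to ys-unique; complete to ys-complete)
      inc : _ → _ → R
      inc x y = ∑ (ends y) (λ a → δ a (g x) x)
      degree : ∀ x → (∃ λ y → (M y ≡ true × x ∈ ends y) × (∀ {y′} → M y′ ≡ true × x ∈ ends y′ → y ≡ y′)) →
        ∑ ys (λ y → if M y then inc x y else ε) ≡ g x
      degree x (y , (My , x∈) , only) = begin
        ∑ ys (λ y → if M y then inc x y else ε)
          ≡⟨ ∑-single ys-unique (ys-complete y) _ other ⟩
        (if M y then inc x y else ε)
          ≡⟨ cong (if_then inc x y else ε) My ⟩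
        inc x y
          ≡⟨ ∑-single (uniq y) x∈ _ (λ a a≢x → δ-diff a (g x) x (a≢x ∘ sym)) ⟩
        δ x (g x) x
          ≡⟨ δ-same x (g x) ⟩
        g x ∎
        where
        other : ∀ y′ → y′ ≢ y → (if M y′ then inc x y′ else ε) ≡ ε
        other y′ y′≢y with M y′ in My′
        ... | false = refl
        ... | true  = ∑-zero (ends y′) λ a a∈ → δ-diff a (g x) x λ { refl → y′≢y (sym (only (My′ , a∈))) }

open Enumeration

module ∑ℕ = Sums _+_ 0 +-assoc +-comm +-identityˡ
module ∑₂ = Sums _xor_ false xor-assoc xor-comm xor-identityˡ

_×ᴱ_ : ∀ {A B} → Enumeration A → Enumeration B → Enumeration (A × B)
𝔸 ×ᴱ 𝔹 = record
  { elements = cartesianProduct (elements 𝔸) (elements 𝔹)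
  ; unique   = cartesianProduct⁺ (unique 𝔸) (unique 𝔹)
  ; complete = λ (x , y) → ∈-cartesianProduct⁺ (complete 𝔸 x) (complete 𝔹 y) }

finᴱ : ∀ n → Enumeration (Fin n)
finᴱ n = record { elements = allFin n ; unique = allFin⁺ n ; complete = ∈-allFin }

joinᴱ : ∀ {A B C} → Enumeration A → Enumeration B → (f : A → C) (g : B → C) →
  (∀ {x y} → f x ≡ f y → x ≡ y) → (∀ {x y} → g x ≡ g y → x ≡ y) → (∀ {x y} → f x ≢ g y) →
  (∀ z → (∃ λ x → f x ≡ z) ⊎ (∃ λ y → g y ≡ z)) → Enumeration C
joinᴱ 𝔸 𝔹 f g f-inj g-inj disj cover = record
  { elements = map f (elements 𝔸) ++ map g (elements 𝔹)
  ; unique   = ++⁺ (map⁺ f-inj (unique 𝔸)) (map⁺ g-inj (unique 𝔹))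
      λ (z∈f , z∈g) → let (x , _ , e) = ∈-map⁻ f z∈f ; (y , _ , e′) = ∈-map⁻ g z∈g
                      in disj (trans (sym e) e′)
  ; complete = λ z → covered z (cover z) }
  where
  covered : ∀ z → (∃ λ x → f x ≡ z) ⊎ (∃ λ y → g y ≡ z) → z ∈ map f (elements 𝔸) ++ map g (elements 𝔹)
  covered z (inj₁ (x , refl)) = ∈-++⁺ˡ (∈-map⁺ f (complete 𝔸 x))
  covered z (inj₂ (y , refl)) = ∈-++⁺ʳ _ (∈-map⁺ g (complete 𝔹 y))

_⊎ᴱ_ : ∀ {A B} → Enumeration A → Enumeration B → Enumeration (A ⊎ B)
𝔸 ⊎ᴱ 𝔹 = joinᴱ 𝔸 𝔹 inj₁ inj₂ inj₁-injective inj₂-injective (λ ()) λ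
  { (inj₁ x) → inj₁ (x , refl) ; (inj₂ y) → inj₂ (y , refl) }

cornerᴱ : Enumeration Corner
cornerᴱ = record
  { elements = SW ∷ SE ∷ NW ∷ NE ∷ []
  ; unique   = ((λ ()) ∷ (λ ()) ∷ (λ ()) ∷ []) ∷ ((λ ()) ∷ (λ ()) ∷ []) ∷ ((λ ()) ∷ []) ∷ [] ∷ []
  ; complete = λ { SW → here refl ; SE → there (here refl)
                 ; NW → there (there (here refl)) ; NE → there (there (there (here refl))) } }

ptᴱ : ∀ m n → Enumeration (Pt m n)
ptᴱ m n = finᴱ (suc m) ×ᴱ finᴱ (suc n)

ctrᴱ : ∀ m n → Enumeration (Ctr m n)
ctrᴱ m n = finᴱ m ×ᴱ finᴱ n

vertexᴱ : ∀ m n → Enumeration (Vertex m n)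
vertexᴱ m n = ptᴱ m n ⊎ᴱ ctrᴱ m n

e1ᴱ : ∀ m n → Enumeration (E1 m n)
e1ᴱ m n = ctrᴱ m n ×ᴱ cornerᴱ

e2ᴱ : ∀ m n → Enumeration (E2 m n)
e2ᴱ m n = joinᴱ (finᴱ m ×ᴱ finᴱ (suc n)) (finᴱ (suc m) ×ᴱ finᴱ n) (uncurry hor) (uncurry ver)
  (λ { refl → refl }) (λ { refl → refl }) (λ ()) λ
  { (hor x y) → inj₁ ((x , y) , refl) ; (ver x y) → inj₂ ((x , y) , refl) }

edgeᴱ : ∀ m n → Enumeration (Edge m n)
edgeᴱ m n = e1ᴱ m n ⊎ᴱ e2ᴱ m n

module _ {m n : ℕ} where

  _≟P_ : DecidableEquality (Pt m n)
  _≟P_ = ×-≡-dec _≟F_ _≟F_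

  _≟C_ : DecidableEquality (Ctr m n)
  _≟C_ = ×-≡-dec _≟F_ _≟F_

  _≟V_ : DecidableEquality (Vertex m n)
  _≟V_ = ⊎-≡-dec _≟P_ _≟C_

-- Corners and diagonals of a unit square

opp : Corner → Corner
opp SW = NE
opp NE = SW
opp SE = NW
opp NW = SE

opp-involutive : ∀ k → opp (opp k) ≡ k
opp-involutive SW = refl
opp-involutive SE = refl
opp-involutive NW = refl
opp-involutive NE = refl

opp-≢ : ∀ k → k ≢ opp k
opp-≢ SW ()
opp-≢ SE ()
opp-≢ NW ()
opp-≢ NE ()

inject₁≢suc : ∀ {n} (i : Fin n) → inject₁ i ≢ suc i
inject₁≢suc i e = contradiction (trans (sym (toℕ-inject₁ i)) (cong toℕ e)) (<⇒≢ ≤-refl)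

cornerPt-injective : ∀ {m n} (c : Ctr m n) k k′ → cornerPt c k ≡ cornerPt c k′ → k ≡ k′
cornerPt-injective c SW SW e = refl
cornerPt-injective (a , b) SW SE e = contradiction (cong proj₁ e) (inject₁≢suc a)
cornerPt-injective (a , b) SW NW e = contradiction (cong proj₂ e) (inject₁≢suc b)
cornerPt-injective (a , b) SW NE e = contradiction (cong proj₁ e) (inject₁≢suc a)
cornerPt-injective (a , b) SE SW e = contradiction (cong proj₁ (sym e)) (inject₁≢suc a)
cornerPt-injective c SE SE e = refl
cornerPt-injective (a , b) SE NW e = contradiction (cong proj₁ (sym e)) (inject₁≢suc a)
cornerPt-injective (a , b) SE NE e = contradiction (cong proj₂ e) (inject₁≢suc b)
cornerPt-injective (a , b) NW SW e = contradiction (cong proj₂ (sym e)) (inject₁≢suc b)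
cornerPt-injective (a , b) NW SE e = contradiction (cong proj₁ e) (inject₁≢suc a)
cornerPt-injective c NW NW e = refl
cornerPt-injective (a , b) NW NE e = contradiction (cong proj₁ e) (inject₁≢suc a)
cornerPt-injective (a , b) NE SW e = contradiction (cong proj₁ (sym e)) (inject₁≢suc a)
cornerPt-injective (a , b) NE SE e = contradiction (cong proj₂ (sym e)) (inject₁≢suc b)
cornerPt-injective (a , b) NE NW e = contradiction (cong proj₁ (sym e)) (inject₁≢suc a)
cornerPt-injective c NE NE e = refl

-- Parity classes of lattice points.

odd : ℕ → Bool
odd zero    = false
odd (suc n) = not (odd n)

2∣⇒¬odd : ∀ {n} → 2 ∣ n → odd n ≡ false
2∣⇒¬odd (divides q refl) = go q
  where
  go : ∀ q → odd (q * 2) ≡ false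
  go zero    = refl
  go (suc q) = trans (not-involutive _) (go q)

¬odd⇒2∣ : ∀ n → odd n ≡ false → 2 ∣ n
¬odd⇒2∣ zero          _ = 2 ∣0
¬odd⇒2∣ (suc (suc n)) e = ∣m∣n⇒∣m+n ∣-refl (¬odd⇒2∣ n (trans (sym (not-involutive _)) e))

parity : ∀ {m n} → Pt m n → Bool
parity (x , y) = odd (toℕ x + toℕ y)

class : Bool → Cls
class false = one
class true  = two

cls : ∀ {m n} → Pt m n → Cls
cls p = class (parity p)

class-injective : ∀ {a b} → class a ≡ class b → a ≡ b
class-injective {false} {false} _ = refl
class-injective {true}  {true}  _ = refl

InV⇒cls : ∀ {m n} j (p : Pt m n) → InV j p → cls p ≡ j
InV⇒cls one p v = cong class (2∣⇒¬odd v)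
InV⇒cls two p v with parity p in e
... | true  = refl
... | false = contradiction (¬odd⇒2∣ _ e) v

InV-cls : ∀ {m n} (p : Pt m n) → InV (cls p) p
InV-cls p with parity p in e
... | false = ¬odd⇒2∣ _ e
... | true  = λ d → case trans (sym e) (2∣⇒¬odd d) of λ ()

cls⇒InV : ∀ {m n j} (p : Pt m n) → cls p ≡ j → InV j p
cls⇒InV p refl = InV-cls p

antidiagonal : Corner → Bool
antidiagonal SW = false
antidiagonal NE = false
antidiagonal SE = true
antidiagonal NW = true

parity-corner : ∀ {m n} (c : Ctr m n) k → parity (cornerPt c k) ≡ antidiagonal k xor odd (toℕ (proj₁ c) + toℕ (proj₂ c))
parity-corner (a , b) SW rewrite toℕ-inject₁ a | toℕ-inject₁ b = refl
parity-corner (a , b) SE rewrite toℕ-inject₁ b = refl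
parity-corner (a , b) NW rewrite toℕ-inject₁ a | +-suc (toℕ a) (toℕ b) = refl
parity-corner (a , b) NE rewrite +-suc (toℕ a) (toℕ b) = not-involutive _

cls-opp : ∀ {m n} (c : Ctr m n) k → cls (cornerPt c (opp k)) ≡ cls (cornerPt c k)
cls-opp c k = cong class (trans (parity-corner c (opp k)) (trans (cong (_xor _) (anti k)) (sym (parity-corner c k))))
  where
  anti : ∀ k → antidiagonal (opp k) ≡ antidiagonal k
  anti SW = refl
  anti SE = refl
  anti NW = refl
  anti NE = refl

xor-cancelʳ : ∀ a b c → a xor c ≡ b xor c → a ≡ b
xor-cancelʳ false false c     e = refl
xor-cancelʳ true  true  c     e = refl
xor-cancelʳ false true  true  ()
xor-cancelʳ false true  false ()
xor-cancelʳ true  false true  ()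
xor-cancelʳ true  false false ()

-- Classes alternate around a square, so a center and a class determine one diagonal.
cls-corner : ∀ {m n} (c : Ctr m n) k k′ → cls (cornerPt c k) ≡ cls (cornerPt c k′) → k′ ≡ k ⊎ k′ ≡ opp k
cls-corner c k k′ e = cases k k′ (xor-cancelʳ _ _ _
  (trans (sym (parity-corner c k)) (trans (class-injective e) (parity-corner c k′))))
  where
  cases : ∀ k k′ → antidiagonal k ≡ antidiagonal k′ → k′ ≡ k ⊎ k′ ≡ opp k
  cases SW SW _ = inj₁ refl
  cases SW NE _ = inj₂ refl
  cases NE SW _ = inj₂ refl
  cases NE NE _ = inj₁ refl
  cases SE SE _ = inj₁ refl
  cases SE NW _ = inj₂ refl
  cases NW SE _ = inj₂ refl
  cases NW NW _ = inj₁ refl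

≢-not : ∀ {a} → a ≢ not a
≢-not {false} ()
≢-not {true}  ()

ends-cls : ∀ {m n} (e : E2 m n) → cls (proj₁ (ends e)) ≢ cls (proj₂ (ends e))
ends-cls (hor x y) e = ≢-not (class-injective (subst (λ i → class (odd (i + toℕ y)) ≡ cls (proj₂ (ends (hor x y)))) (toℕ-inject₁ x) e))
ends-cls (ver x y) e = ≢-not (trans
  (class-injective (subst (λ i → class (odd (toℕ x + i)) ≡ cls (proj₂ (ends (ver x y)))) (toℕ-inject₁ y) e))
  (cong odd (+-suc (toℕ x) (toℕ y))))

-- Diagonal coordinates.

cornerPos : ℕ → ℕ → Corner → Pos
cornerPos u v SW = u , suc v
cornerPos u v NE = suc (suc u) , suc v
cornerPos u v NW = suc u , v
cornerPos u v SE = suc u , suc (suc v)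

-- Points whose ray crosses the antidiagonal from (U + 1 , V) to (U + 1 , V + 2).
shadow : ℕ → ℕ → Pos → Bool
shadow U V (u , v) = ((v <ᵇ V) xor (v <ᵇ 2 + V)) ∧ (u <ᵇ suc U)

between : ∀ v V → (v <ᵇ V) xor (v <ᵇ 2 + V) ≡ true → v ≡ V ⊎ v ≡ suc V
between zero    zero    _ = inj₁ refl
between (suc zero) zero _ = inj₂ refl
between (suc v) (suc V) e with between v V e
... | inj₁ refl = inj₁ refl
... | inj₂ refl = inj₂ refl

¬shadow : ∀ {U V} p → (proj₁ p ≤ U → V ≤ proj₂ p → proj₂ p ≤ suc V → ⊥) → shadow U V p ≡ false
¬shadow {U} {V} (u , v) h with (v <ᵇ V) xor (v <ᵇ 2 + V) in ev | u <ᵇ suc U in eu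
... | false | _     = refl
... | true  | false = refl
... | true  | true with between v V ev
...   | inj₁ refl = ⊥-elim (h (s≤s⁻¹ (<ᵇ-true⁻ u _ eu)) ≤-refl (n≤1+n _))
...   | inj₂ refl = ⊥-elim (h (s≤s⁻¹ (<ᵇ-true⁻ u _ eu)) (n≤1+n _) ≤-refl)

-- Half of `v`, rounded down, mod 2. An antidiagonal changes `v` by two and flips it, a diagonal
-- keeps `v`: it is the potential whose differences telescope along a cycle.
level : ℕ → Bool
level zero          = false
level (suc zero)    = false
level (suc (suc v)) = not (level v)

module _ {m n : ℕ} where

  -- u = x + y and v = x − y + n; all vertices then lie on ℤ², and edges of E₁ are unit steps.
  pos : Vertex m n → Pos
  pos (inj₁ (x , y)) = toℕ x + toℕ y , toℕ x + (n ∸ toℕ y)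
  pos (inj₂ (a , b)) = suc (toℕ a + toℕ b) , toℕ a + (n ∸ toℕ b)

  -- The lower left corner of the box around the four corners in diagonal coordinates. The center is
  -- at `(1 + diagU , 1 + diagV)`, so no subtraction appears in `cornerPos`.
  diagU diagV : Ctr m n → ℕ
  diagU (a , b) = toℕ a + toℕ b
  diagV (a , b) = toℕ a + (n ∸ suc (toℕ b))

  ∸-step : ∀ (b : Fin n) → n ∸ toℕ b ≡ suc (n ∸ suc (toℕ b))
  ∸-step b = +-∸-assoc 1 (toℕ<n b)

  pos-ctr : ∀ c → pos (inj₂ c) ≡ (suc (diagU c) , suc (diagV c))
  pos-ctr (a , b) = cong (suc (toℕ a + toℕ b) ,_) (trans (cong (toℕ a +_) (∸-step b)) (+-suc (toℕ a) _))

  pos-corner : ∀ c k → pos (inj₁ (cornerPt c k)) ≡ cornerPos (diagU c) (diagV c) k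
  pos-corner (a , b) SW rewrite toℕ-inject₁ a | toℕ-inject₁ b | ∸-step b | +-suc (toℕ a) (n ∸ suc (toℕ b)) = refl
  pos-corner (a , b) SE rewrite toℕ-inject₁ b | ∸-step b | +-suc (toℕ a) (n ∸ suc (toℕ b)) = refl
  pos-corner (a , b) NW rewrite toℕ-inject₁ a | +-suc (toℕ a) (toℕ b) = refl
  pos-corner (a , b) NE rewrite +-suc (toℕ a) (toℕ b) = refl

  diagonal-elim : ∀ (P : Pos → Pos → Pos → Set) c k →
    P (cornerPos (diagU c) (diagV c) k) (suc (diagU c) , suc (diagV c)) (cornerPos (diagU c) (diagV c) (opp k)) →
    P (pos (inj₁ (cornerPt c k))) (pos (inj₂ c)) (pos (inj₁ (cornerPt c (opp k))))
  diagonal-elim P c k r = subst (λ o → P (pos (inj₁ (cornerPt c k))) o (pos (inj₁ (cornerPt c (opp k))))) (sym (pos-ctr c))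
    (subst₂ (λ q q′ → P q (suc (diagU c) , suc (diagV c)) q′) (sym (pos-corner c k)) (sym (pos-corner c (opp k))) r)

  corner-adj : ∀ c k → Adj (pos (inj₁ (cornerPt c k))) (pos (inj₂ c))
  corner-adj c k rewrite pos-ctr c | pos-corner c k = go k
    where
    go : ∀ {u v} k → Adj (cornerPos u v k) (suc u , suc v)
    go SW = u⁺
    go SE = v⁻
    go NW = v⁺
    go NE = u⁻

  ctr-adj : ∀ c k → Adj (pos (inj₂ c)) (pos (inj₁ (cornerPt c k)))
  ctr-adj c k rewrite pos-ctr c | pos-corner c k = go k
    where
    go : ∀ {u v} k → Adj (suc u , suc v) (cornerPos u v k)
    go SW = u⁻
    go SE = v⁺
    go NW = v⁻
    go NE = u⁺

  -- `u + v` determines `x`, and it is `2 * x + n` at a lattice point but one more than such a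
  -- number at a center. This parity keeps points and centers apart.
  half-sum : ∀ x y → y ≤ n → (x + y) + (x + (n ∸ y)) ≡ 2 * x + n
  half-sum x y y≤n = begin
    (x + y) + (x + (n ∸ y))  ≡⟨ +-assoc x y _ ⟩
    x + (y + (x + (n ∸ y)))  ≡⟨ cong (x +_) (+-assoc y x _) ⟨
    x + ((y + x) + (n ∸ y))  ≡⟨ cong (λ z → x + (z + (n ∸ y))) (+-comm y x) ⟩
    x + ((x + y) + (n ∸ y))  ≡⟨ cong (x +_) (+-assoc x y _) ⟩
    x + (x + (y + (n ∸ y)))  ≡⟨ cong (λ z → x + (x + z)) (m+[n∸m]≡n y≤n) ⟩
    x + (x + n)              ≡⟨ +-assoc x x n ⟨
    (x + x) + n              ≡⟨ cong (λ z → (x + z) + n) (+-identityʳ x) ⟨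
    2 * x + n                ∎
    where open ≡-Reasoning

  coords-injective : ∀ {x y x′ y′} → y ≤ n → y′ ≤ n → x + y ≡ x′ + y′ → x + (n ∸ y) ≡ x′ + (n ∸ y′) → x ≡ x′ × y ≡ y′
  coords-injective {x} {y} {x′} {y′} y≤ y′≤ eu ev with
    *-cancelˡ-≡ x x′ 2 (+-cancelʳ-≡ n _ _ (trans (sym (half-sum x y y≤)) (trans (cong₂ _+_ eu ev) (half-sum x′ y′ y′≤))))
  ... | refl = refl , +-cancelˡ-≡ x y y′ eu

  pt≢ctr : ∀ {x y a b} → y ≤ n → b ≤ n → x + y ≡ suc (a + b) → x + (n ∸ y) ≢ a + (n ∸ b)
  pt≢ctr {x} {y} {a} {b} y≤ b≤ eu ev = even≢odd x a (+-cancelʳ-≡ n _ _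
    (trans (sym (half-sum x y y≤)) (trans (cong₂ _+_ eu ev) (cong suc (half-sum a b b≤)))))

  pos-injective : ∀ x y → pos x ≡ pos y → x ≡ y
  pos-injective (inj₁ (x , y)) (inj₁ (x′ , y′)) e
    with coords-injective (toℕ≤pred[n] y) (toℕ≤pred[n] y′) (cong proj₁ e) (cong proj₂ e)
  ... | ex , ey = cong inj₁ (cong₂ _,_ (toℕ-injective ex) (toℕ-injective ey))
  pos-injective (inj₁ (x , y)) (inj₂ (a , b)) e =
    contradiction (cong proj₂ e) (pt≢ctr (toℕ≤pred[n] y) (<⇒≤ (toℕ<n b)) (cong proj₁ e))
  pos-injective (inj₂ (a , b)) (inj₁ (x , y)) e =
    contradiction (cong proj₂ (sym e)) (pt≢ctr (toℕ≤pred[n] y) (<⇒≤ (toℕ<n b)) (cong proj₁ (sym e)))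
  pos-injective (inj₂ (x , y)) (inj₂ (x′ , y′)) e
    with coords-injective (<⇒≤ (toℕ<n y)) (<⇒≤ (toℕ<n y′)) (suc-injective (cong proj₁ e)) (cong proj₂ e)
  ... | ex , ey = cong inj₂ (cong₂ _,_ (toℕ-injective ex) (toℕ-injective ey))

  -- An impurity is not a unit step in diagonal coordinates, so the winding numbers of its ends have
  -- to be compared through a center adjacent to both. On the boundary the square is taken on the
  -- side inside the rectangle.
  ends-common-center : 1 ≤ m → 1 ≤ n → (e : E2 m n) →
    Σ (Ctr m n) λ c → Σ Corner λ k → Σ Corner λ k′ → proj₁ (ends e) ≡ cornerPt c k × proj₂ (ends e) ≡ cornerPt c k′
  ends-common-center _ (s≤s _) (hor x zero)    = (x , zero) , SW , SE , refl , refl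
  ends-common-center _ _       (hor x (suc y)) = (x , y) , NW , NE , refl , refl
  ends-common-center (s≤s _) _ (ver zero y)    = (zero , y) , SW , NW , refl , refl
  ends-common-center _ _       (ver (suc x) y) = (x , y) , SE , NE , refl , refl

  open ∑₂ using (∑; ∑-cong; ∑-zero; ∑-∙; ∑-++; ∑-map; ∑-×; ∑-last; ∑-single)

  ∑-pts-restrict : ∀ g → (∀ y → g (fromℕ m , y) ≡ false) → (∀ x → g (x , fromℕ n) ≡ false) →
    ∑ (elements (ptᴱ m n)) g ≡ ∑ (elements (ctrᴱ m n)) (λ c → g (cornerPt c SW))
  ∑-pts-restrict g right-side top-side = begin
    ∑ (elements (ptᴱ m n)) g
      ≡⟨ ∑-× (allFin (suc m)) (allFin (suc n)) g ⟩
    ∑ (allFin (suc m)) (λ x → ∑ (allFin (suc n)) (λ y → g (x , y)))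
      ≡⟨ ∑-last m (λ x → ∑ (allFin (suc n)) (λ y → g (x , y))) ⟩
    ∑ (allFin m) (λ x → ∑ (allFin (suc n)) (λ y → g (inject₁ x , y))) xor ∑ (allFin (suc n)) (λ y → g (fromℕ m , y))
      ≡⟨ cong (∑ (allFin m) (λ x → ∑ (allFin (suc n)) (λ y → g (inject₁ x , y))) xor_)
           (∑-zero (allFin (suc n)) λ y _ → right-side y) ⟩
    ∑ (allFin m) (λ x → ∑ (allFin (suc n)) (λ y → g (inject₁ x , y))) xor false
      ≡⟨ xor-identityʳ _ ⟩
    ∑ (allFin m) (λ x → ∑ (allFin (suc n)) (λ y → g (inject₁ x , y)))
      ≡⟨ ∑-cong (allFin m) (λ x → trans (∑-last n (λ y → g (inject₁ x , y))) (trans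
           (cong (∑ (allFin n) (λ y → g (inject₁ x , inject₁ y)) xor_) (top-side (inject₁ x))) (xor-identityʳ _))) ⟩
    ∑ (allFin m) (λ x → ∑ (allFin n) (λ y → g (inject₁ x , inject₁ y)))
      ≡⟨ ∑-× (allFin m) (allFin n) (λ c → g (cornerPt c SW)) ⟨
    ∑ (elements (ctrᴱ m n)) (λ c → g (cornerPt c SW)) ∎
    where open ≡-Reasoning

  ∑-vertices : ∀ g → ∑ (elements (vertexᴱ m n)) g ≡
    ∑ (elements (ptᴱ m n)) (g ∘ inj₁) xor ∑ (elements (ctrᴱ m n)) (g ∘ inj₂)
  ∑-vertices g = trans (∑-++ (map inj₁ (elements (ptᴱ m n))) _ g)
    (cong₂ _xor_ (∑-map inj₁ (elements (ptᴱ m n)) g) (∑-map inj₂ (elements (ctrᴱ m n)) g))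

  -- The points (x , y) and the centers (x , y) cancel, except at the given center.
  shadow-odd : ∀ c → ∑ (elements (vertexᴱ m n)) (shadow (diagU c) (diagV c) ∘ pos) ≡ true
  shadow-odd c@(a , b) = begin
    ∑ (elements (vertexᴱ m n)) (h ∘ pos)
      ≡⟨ ∑-vertices (h ∘ pos) ⟩
    ∑ (elements (ptᴱ m n)) (h ∘ pos ∘ inj₁) xor ∑ (elements (ctrᴱ m n)) (h ∘ pos ∘ inj₂)
      ≡⟨ cong (_xor ∑ (elements (ctrᴱ m n)) (h ∘ pos ∘ inj₂))
           (∑-pts-restrict (h ∘ pos ∘ inj₁) right-side top-side) ⟩
    ∑ (elements (ctrᴱ m n)) (λ c′ → h (pos (inj₁ (cornerPt c′ SW)))) xor ∑ (elements (ctrᴱ m n)) (h ∘ pos ∘ inj₂)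
      ≡⟨ ∑-∙ (elements (ctrᴱ m n)) _ _ ⟨
    ∑ (elements (ctrᴱ m n)) (λ c′ → h (pos (inj₁ (cornerPt c′ SW))) xor h (pos (inj₂ c′)))
      ≡⟨ ∑-cong (elements (ctrᴱ m n)) (λ (x , y) → cong₂ (λ i j → h (i + j , i + (n ∸ j)) xor h (pos (inj₂ (x , y))))
           (toℕ-inject₁ x) (toℕ-inject₁ y)) ⟩
    ∑ (elements (ctrᴱ m n)) pair
      ≡⟨ ∑-single (unique (ctrᴱ m n)) (complete (ctrᴱ m n) c) pair other ⟩
    pair c
      ≡⟨ self ⟩
    true ∎
    where
    open ≡-Reasoning
    U V : ℕ
    U = diagU c
    V = diagV c
    h : Pos → Bool
    h = shadow U V
    pair : Ctr m n → Bool
    pair (x , y) = h (toℕ x + toℕ y , toℕ x + (n ∸ toℕ y)) xor h (pos (inj₂ (x , y)))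
    -- A point of the right side in the shadow would have `y < b`, which puts it above the strip.
    -- Likewise one of the top side would have `x < a`, which puts it below.
    right-side : ∀ y → h (pos (inj₁ (fromℕ m , y))) ≡ false
    right-side y rewrite toℕ-fromℕ m = ¬shadow (m + toℕ y , m + (n ∸ toℕ y)) λ low _ high →
      1+n≰n (≤-trans (≤-trans
        (≤-reflexive (cong suc (trans (sym (+-suc (toℕ a) _)) (cong (toℕ a +_) (sym (∸-step b))))))
        (+-mono-≤ (toℕ<n a) (∸-monoʳ-≤ n (<⇒≤ (y<b low))))) high)
      where
      y<b : m + toℕ y ≤ U → toℕ y < toℕ b
      y<b low = +-cancelˡ-≤ (toℕ a) _ _ (≤-trans (≤-reflexive (+-suc (toℕ a) (toℕ y)))
        (≤-trans (+-monoˡ-≤ (toℕ y) (toℕ<n a)) low))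
    top-side : ∀ x → h (pos (inj₁ (x , fromℕ n))) ≡ false
    top-side x rewrite toℕ-fromℕ n | n∸n≡0 n | +-identityʳ (toℕ x) = ¬shadow (toℕ x + n , toℕ x) λ low high _ →
      1+n≰n (≤-trans (x<a low) (≤-trans (m≤m+n (toℕ a) _) high))
      where
      x<a : toℕ x + n ≤ U → toℕ x < toℕ a
      x<a low = +-cancelʳ-≤ (toℕ b) _ _ (≤-trans (≤-reflexive (sym (+-suc (toℕ x) (toℕ b))))
        (≤-trans (+-monoʳ-≤ (toℕ x) (toℕ<n b)) low))
    other : ∀ c′ → c′ ≢ c → pair c′ ≡ false
    other (x , y) c′≢c = ∧-xor-false _ (u <ᵇ suc U) (suc u <ᵇ suc U) λ ev eu →
      contra (suc-injective (<ᵇ-jumpˡ u (suc U) eu)) (between (toℕ x + (n ∸ toℕ y)) V ev)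
      where
      u : ℕ
      u = toℕ x + toℕ y
      contra : u ≡ U → toℕ x + (n ∸ toℕ y) ≡ V ⊎ toℕ x + (n ∸ toℕ y) ≡ suc V → ⊥
      -- At this height the center `(x , y)` would coincide with the NW corner of `c`, a lattice
      -- point.
      contra eu (inj₁ ev) = pt≢ctr (toℕ<n b) (<⇒≤ (toℕ<n y)) (trans (+-suc (toℕ a) (toℕ b)) (cong suc (sym eu))) (sym ev)
      contra eu (inj₂ ev) with coords-injective (<⇒≤ (toℕ<n y)) (<⇒≤ (toℕ<n b)) eu
                                 (trans ev (trans (sym (+-suc (toℕ a) _)) (cong (toℕ a +_) (sym (∸-step b)))))
      ... | ex , ey = c′≢c (cong₂ _,_ (toℕ-injective ex) (toℕ-injective ey))
    self : pair c ≡ true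
    self rewrite ∸-step b | +-suc (toℕ a) (n ∸ suc (toℕ b))
               | <ᵇ-false {suc V} {V} (n≤1+n V) | <ᵇ-true {V} {suc V} ≤-refl
               | <ᵇ-true {U} {suc U} ≤-refl | <ᵇ-false {U} {U} ≤-refl = refl

  rays : Pos → Pos → Bool
  rays q q′ = ∑ (elements (vertexᴱ m n)) (λ x → cross (pos x) q q′)

  -- In diagonal coordinates a diagonal between SW and NE is horizontal: no ray crosses it and the
  -- level stays. One between NW and SE is crossed by the rays of its shadow, an odd number, and
  -- flips the level.
  rays-diagonal : ∀ c k → rays (pos (inj₁ (cornerPt c k))) (pos (inj₂ c)) xor rays (pos (inj₂ c)) (pos (inj₁ (cornerPt c (opp k))))
    ≡ level (proj₂ (pos (inj₁ (cornerPt c k)))) xor level (proj₂ (pos (inj₁ (cornerPt c (opp k)))))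
  rays-diagonal c k = diagonal-elim Claim c k (go k)
    where
    Claim : Pos → Pos → Pos → Set
    Claim q o q′ = rays q o xor rays o q′ ≡ level (proj₂ q) xor level (proj₂ q′)
    U V : ℕ
    U = diagU c
    V = diagV c
    flat : ∀ u u′ → rays (u , suc V) (u′ , suc V) ≡ false
    flat u u′ = ∑-zero (elements (vertexᴱ m n)) λ x _ → cong (_∧ _) (xor-same (proj₂ (pos x) <ᵇ suc V))
    steep : ∀ v v′ → (∀ (f : ℕ → Bool) → f v xor f v′ ≡ f V xor f (2 + V)) →
      rays (suc U , v) (suc U , suc V) xor rays (suc U , suc V) (suc U , v′) ≡ true
    steep v v′ sym-ends = trans (sym (∑-∙ (elements (vertexᴱ m n))
        (λ x → cross (pos x) (suc U , v) (suc U , suc V)) (λ x → cross (pos x) (suc U , suc V) (suc U , v′)))) (trans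
      (∑-cong (elements (vertexᴱ m n)) λ x → join (pos x)) (shadow-odd c))
      where
      join : ∀ p → cross p (suc U , v) (suc U , suc V) xor cross p (suc U , suc V) (suc U , v′) ≡ shadow U V p
      join (u , w) = trans (sym (∧-distribʳ-xor (u <ᵇ suc U) ((w <ᵇ v) xor (w <ᵇ suc V)) _))
        (cong (_∧ (u <ᵇ suc U)) (trans (xor-cancel-middle (w <ᵇ v) (w <ᵇ suc V) (w <ᵇ v′)) (sym-ends (w <ᵇ_))))
    go : ∀ k → Claim (cornerPos U V k) (suc U , suc V) (cornerPos U V (opp k))
    go SW = trans (cong₂ _xor_ (flat U (suc U)) (flat (suc U) (2 + U))) (sym (xor-same (level (suc V))))
    go NE = trans (cong₂ _xor_ (flat (2 + U) (suc U)) (flat (suc U) U)) (sym (xor-same (level (suc V))))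
    go NW = trans (steep V (2 + V) λ f → refl) (sym (xor-inverseʳ (level V)))
    go SE = trans (steep (2 + V) V λ f → xor-comm (f (2 + V)) (f V)) (sym (xor-inverseˡ (level V)))

-- Indices along an alternating path, and incidence

⨁-single : ∀ n f s → s < n → (∀ t → t < n → t ≢ s → f t ≡ false) → ⨁ n f ≡ f s
⨁-single (suc n) f s s<n other with m≤n⇒m<n∨m≡n s<n
... | inj₂ refl = cong (_xor f s) (⨁-zero n λ t t< → other t (m<n⇒m<1+n t<) (<⇒≢ t<))
... | inj₁ s<   = trans (cong₂ _xor_ (⨁-single n f s (s≤s⁻¹ s<) λ t t< → other t (m<n⇒m<1+n t<))
                                     (other n ≤-refl (≢-sym (<⇒≢ (s≤s⁻¹ s<)))))
                        (xor-identityʳ (f s))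

∑-⨁-comm : ∀ {A : Set} (xs : List A) n (f : A → ℕ → Bool) →
  ∑₂.∑ xs (λ x → ⨁ n (f x)) ≡ ⨁ n (λ s → ∑₂.∑ xs (λ x → f x s))
∑-⨁-comm xs zero    f = ∑₂.∑-zero xs λ _ _ → refl
∑-⨁-comm xs (suc n) f = trans (∑₂.∑-∙ xs (λ x → ⨁ n (f x)) (λ x → f x n))
  (cong (_xor ∑₂.∑ xs (λ x → f x n)) (∑-⨁-comm xs n f))

halve : ∀ s → ∃ λ i → s ≡ i + i ⊎ s ≡ suc (i + i)
halve zero = 0 , inj₁ refl
halve (suc s) with halve s
... | i , inj₁ refl = i , inj₂ refl
... | i , inj₂ refl = suc i , inj₁ (cong suc (sym (+-suc i i)))

halve-< : ∀ {i j} → i + i < j + j → i < j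
halve-< {i} {j} lt = ≰⇒> λ j≤i → <⇒≱ lt (+-mono-≤ j≤i j≤i)

cls-dichotomy : ∀ (x y z : Cls) → x ≢ y → x ≡ z ⊎ y ≡ z
cls-dichotomy one one z   ne = contradiction refl ne
cls-dichotomy one two one ne = inj₁ refl
cls-dichotomy one two two ne = inj₂ refl
cls-dichotomy two one one ne = inj₂ refl
cls-dichotomy two one two ne = inj₁ refl
cls-dichotomy two two z   ne = contradiction refl ne

module _ {m n : ℕ} where

  endsOf : Edge m n → List (Vertex m n)
  endsOf (inj₁ (c , k)) = inj₁ (cornerPt c k) ∷ inj₂ c ∷ []
  endsOf (inj₂ e)       = inj₁ (proj₁ (ends e)) ∷ inj₁ (proj₂ (ends e)) ∷ []

  endsOf-unique : ∀ e → Unique (endsOf e)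
  endsOf-unique (inj₁ (c , k)) = ((λ ()) ∷ []) ∷ [] ∷ []
  endsOf-unique (inj₂ e) = ((λ eq → ends-cls e (cong cls (inj₁-injective eq))) ∷ []) ∷ [] ∷ []

  Incident⇒∈ : ∀ v e → Incident v e → v ∈ endsOf e
  Incident⇒∈ v (inj₁ _) (inj₁ refl) = here refl
  Incident⇒∈ v (inj₁ _) (inj₂ refl) = there (here refl)
  Incident⇒∈ v (inj₂ _) (inj₁ refl) = here refl
  Incident⇒∈ v (inj₂ _) (inj₂ refl) = there (here refl)

  ∈⇒Incident : ∀ v e → v ∈ endsOf e → Incident v e
  ∈⇒Incident v (inj₁ _) (here refl) = inj₁ refl
  ∈⇒Incident v (inj₁ _) (there (here refl)) = inj₂ refl
  ∈⇒Incident v (inj₂ _) (here refl) = inj₁ refl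
  ∈⇒Incident v (inj₂ _) (there (here refl)) = inj₂ refl

  IsEnd⇒Incident : ∀ {p} {e : E2 m n} → IsEnd p e → Incident (inj₁ p) (inj₂ e)
  IsEnd⇒Incident (inj₁ refl) = inj₁ refl
  IsEnd⇒Incident (inj₂ refl) = inj₂ refl

  Incident⇒IsEnd : ∀ {p} {e : E2 m n} → Incident (inj₁ p) (inj₂ e) → IsEnd p e
  Incident⇒IsEnd (inj₁ refl) = inj₁ refl
  Incident⇒IsEnd (inj₂ refl) = inj₂ refl

-- The orientation defined by a dimer covering

module Matching {m n : ℕ} (M : Edge m n → Bool) (D : IsDimer M) where

  matched : (c : Ctr m n) → Σ Corner λ k → M (inj₁ (c , k)) ≡ true × (∀ {k′} → M (inj₁ (c , k′)) ≡ true → k ≡ k′)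
  matched c with D (inj₂ c)
  ... | inj₁ (_ , k) , (Me , inj₂ refl) , only =
    k , Me , λ Me′ → cong proj₂ (inj₁-injective (only (Me′ , inj₂ refl)))
  ... | inj₁ _ , (_ , inj₁ ()) , _
  ... | inj₂ _ , (_ , inj₁ ()) , _
  ... | inj₂ _ , (_ , inj₂ ()) , _

  corner : Ctr m n → Corner
  corner c = proj₁ (matched c)

  child parent : Ctr m n → Pt m n
  child  c = cornerPt c (corner c)
  parent c = cornerPt c (opp (corner c))

  NonRoot Root : Pt m n → Set
  NonRoot p = ∃ λ c → child c ≡ p
  Root p    = ∃ λ e → M (inj₂ e) ≡ true × IsEnd p e

  classify : ∀ p → NonRoot p ⊎ Root p
  classify p with D (inj₁ p)
  ... | inj₁ (c , k) , (Me , inj₁ refl) , _ = inj₁ (c , cong (cornerPt c) (proj₂ (proj₂ (matched c)) Me))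
  ... | inj₂ e , (Me , inc) , _ = inj₂ (e , Me , Incident⇒IsEnd {e = e} inc)

  same-edge : ∀ {v e e′} → M e ≡ true → Incident v e → M e′ ≡ true → Incident v e′ → e ≡ e′
  same-edge {v} Me i Me′ i′ with D v
  ... | _ , _ , only = trans (sym (only (Me , i))) (only (Me′ , i′))

  child-injective : ∀ {c c′} → child c ≡ child c′ → c ≡ c′
  child-injective {c} {c′} e = cong proj₁ (inj₁-injective
    (same-edge (proj₁ (proj₂ (matched c))) (inj₁ refl) (proj₁ (proj₂ (matched c′))) (inj₁ (cong inj₁ e))))

  NonRoot⇒¬Root : ∀ {p} → NonRoot p → ¬ Root p
  NonRoot⇒¬Root (c , refl) (e , Me , end)
    with () ← same-edge (proj₁ (proj₂ (matched c))) (inj₁ refl) Me (IsEnd⇒Incident {e = e} end)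

  root-edge-unique : ∀ {p e e′} → M (inj₂ e) ≡ true → IsEnd p e → M (inj₂ e′) ≡ true → IsEnd p e′ → e ≡ e′
  root-edge-unique {e = e} {e′} Me end Me′ end′ =
    inj₂-injective (same-edge Me (IsEnd⇒Incident {e = e} end) Me′ (IsEnd⇒Incident {e = e′} end′))

  -- Roots are fixed, so an orbit that reaches an impurity stays there and `iter N` with large `N`
  -- yields its end.
  next : Pt m n → Pt m n
  next p with classify p
  ... | inj₁ (c , _) = parent c
  ... | inj₂ _       = p

  -- For a root the value is junk.
  center : Pt m n → Vertex m n
  center p with classify p
  ... | inj₁ (c , _) = inj₂ c
  ... | inj₂ _       = inj₁ p

  next-child : ∀ c → next (child c) ≡ parent c
  next-child c with classify (child c)
  ... | inj₁ (c′ , e) = cong parent (child-injective e)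
  ... | inj₂ r        = contradiction r (NonRoot⇒¬Root (c , refl))

  center-child : ∀ c → center (child c) ≡ inj₂ c
  center-child c with classify (child c)
  ... | inj₁ (c′ , e) = cong inj₂ (child-injective e)
  ... | inj₂ r        = contradiction r (NonRoot⇒¬Root (c , refl))

  next-root : ∀ {p} → Root p → next p ≡ p
  next-root {p} r with classify p
  ... | inj₁ nr = contradiction r (NonRoot⇒¬Root nr)
  ... | inj₂ _  = refl

  iter : ℕ → Pt m n → Pt m n
  iter zero    p = p
  iter (suc i) p = iter i (next p)

  iter-+ : ∀ i j p → iter (i + j) p ≡ iter j (iter i p)
  iter-+ zero    j p = refl
  iter-+ (suc i) j p = iter-+ i j (next p)

  iter-root : ∀ i {p} → Root p → iter i p ≡ p
  iter-root zero    r = refl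
  iter-root (suc i) r = trans (cong (iter i) (next-root r)) (iter-root i r)

  iter-suc : ∀ i p → iter (suc i) p ≡ next (iter i p)
  iter-suc zero    p = refl
  iter-suc (suc i) p = iter-suc i (next p)

  ∑-matched : (g : Vertex m n → Bool) → (∀ e → M e ≡ true → ∑₂.∑ (endsOf e) g ≡ false) →
    ∑₂.∑ (elements (vertexᴱ m n)) g ≡ false
  ∑-matched g even = trans
    (∑₂.double-counting _≟V_ (vertexᴱ m n) (edgeᴱ m n) M endsOf endsOf-unique incidence g)
    (∑₂.∑-zero (elements (edgeᴱ m n)) λ e _ → zero-term e)
    where
    incidence : ∀ v → ∃ λ e → (M e ≡ true × v ∈ endsOf e) × (∀ {e′} → M e′ ≡ true × v ∈ endsOf e′ → e ≡ e′)
    incidence v with D v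
    ... | e , (Me , i) , only = e , (Me , Incident⇒∈ v e i) , λ {e′} (Me′ , i′) → only (Me′ , ∈⇒Incident v e′ i′)
    zero-term : ∀ e → (if M e then ∑₂.∑ (endsOf e) g else false) ≡ false
    zero-term e with M e in Me
    ... | true  = even e Me
    ... | false = refl

  path : ℕ → Pt m n → Vertex m n
  path zero          p = inj₁ p
  path (suc zero)    p = center p
  path (suc (suc s)) p = path s (next p)

  path-even : ∀ i p → path (i + i) p ≡ inj₁ (iter i p)
  path-even zero    p = refl
  path-even (suc i) p rewrite +-suc i i = path-even i (next p)

  path-odd : ∀ i p → path (suc (i + i)) p ≡ center (iter i p)
  path-odd zero    p = refl
  path-odd (suc i) p rewrite +-suc i i = path-odd i (next p)

  path-adj : ∀ s p → (∀ i → NonRoot (iter i p)) → Adj (pos (path s p)) (pos (path (suc s) p))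
  path-adj zero p nr with nr 0
  ... | c , refl rewrite center-child c = corner-adj c (corner c)
  path-adj (suc zero) p nr with nr 0
  ... | c , refl rewrite center-child c | next-child c = ctr-adj c (opp (corner c))
  path-adj (suc (suc s)) p nr = path-adj s (next p) (nr ∘ suc)

  -- A simple directed cycle is impossible

  module SimpleCycle (1≤m : 1 ≤ m) (1≤n : 1 ≤ n) (h : ℕ) (p : Pt m n)
    (return  : iter (suc h) p ≡ p)
    (nonroot : ∀ i → NonRoot (iter i p))
    (minimal : ∀ i → pos (inj₁ p) ≼ pos (inj₁ (iter i p)))
    (simple  : ∀ i j → i < j → j < suc h → iter i p ≢ iter j p)
    where

    L : ℕ
    -- `suc h` lattice points and equally many centers, in the shape `2 + N` with `N` even that
    -- `self-crossings` requires.
    L = 2 + (h + h)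

    double : suc h + suc h ≡ L
    double = cong suc (+-suc h h)

    κ : ℕ → Vertex m n
    κ s = path s p

    γ : ℕ → Pos
    γ s = pos (κ s)

    κ-closed : κ L ≡ κ 0
    κ-closed = trans (path-even h (next p)) (cong inj₁ return)

    γ-adj : ∀ s → Adj (γ s) (γ (suc s))
    γ-adj s = path-adj s p nonroot

    even-bound : ∀ {i} → i + i < L → i < suc h
    even-bound {i} lt = halve-< (subst (i + i <_) (sym double) lt)

    odd-bound : ∀ {i} → suc (i + i) < L → i < suc h
    odd-bound lt = even-bound (<-trans ≤-refl lt)

    κ-even : ∀ i → κ (i + i) ≡ inj₁ (iter i p)
    κ-even i = path-even i p

    κ-odd : ∀ i → ∃ λ c → κ (suc (i + i)) ≡ inj₂ c × child c ≡ iter i p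
    κ-odd i with nonroot i
    ... | c , e = c , trans (path-odd i p) (trans (cong center (sym e)) (center-child c)) , e

    κ-injective : ∀ s t → s < t → t < L → κ s ≢ κ t
    κ-injective s t s<t t<L e with halve s | halve t
    ... | i , inj₁ refl | j , inj₁ refl = simple i j (halve-< s<t) (even-bound t<L)
          (inj₁-injective (trans (sym (κ-even i)) (trans e (κ-even j))))
    ... | i , inj₁ refl | j , inj₂ refl with κ-odd j
    ...   | c , e′ , _ with () ← trans (sym (κ-even i)) (trans e e′)
    κ-injective s t s<t t<L e | i , inj₂ refl | j , inj₁ refl with κ-odd i
    ...   | c , e′ , _ with () ← trans (sym e′) (trans e (κ-even j))
    κ-injective s t s<t t<L e | i , inj₂ refl | j , inj₂ refl with κ-odd i | κ-odd j
    ...   | c , e₁ , f₁ | c′ , e₂ , f₂ with refl ← trans (sym e₁) (trans e e₂) =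
      simple i j (halve-< (s≤s⁻¹ s<t)) (odd-bound t<L) (trans (sym f₁) f₂)

    γ-injective : ∀ s t → s < t → t < L → γ s ≢ γ t
    γ-injective s t s<t t<L e = κ-injective s t s<t t<L (pos-injective (κ s) (κ t) e)

    -- A center is the midpoint of two consecutive lattice points of the cycle.
    center-upper : ∀ c → pos (inj₁ p) ≼ pos (inj₁ (child c)) → pos (inj₁ p) ≼ pos (inj₁ (parent c)) →
      upper (pos (inj₁ p)) (pos (inj₂ c)) ≡ true
    center-upper c a b = subst (λ q → upper (pos (inj₁ p)) q ≡ true) (sym (pos-ctr c))
      (go (corner c) (subst (pos (inj₁ p) ≼_) (pos-corner c _) a) (subst (pos (inj₁ p) ≼_) (pos-corner c _) b))
      where
      east : ∀ {q u v} → q ≼ (suc u , v) → upper q (u , v) ≡ true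
      east {q} (lex low left) = ≼⇒upper (lex low λ e → <⇒≤ (left e)) λ { refl → 1+n≰n (left refl) }
      north : ∀ {q u v} → q ≼ (u , v) → upper q (u , suc v) ≡ true
      north {q} {u} {v} (lex low left) rewrite <ᵇ-true (s≤s low) = refl
      go : ∀ k {q u v} → q ≼ cornerPos u v k → q ≼ cornerPos u v (opp k) → upper q (suc u , suc v) ≡ true
      go SW _ b = east b
      go NE a _ = east a
      go SE _ b = north b
      go NW a _ = north a

    γ-extreme : ∀ t → 0 < t → t < L → upper (γ 0) (γ t) ≡ true
    γ-extreme t 0<t t<L with halve t
    ... | zero  , inj₁ refl with () ← 0<t
    ... | suc i , inj₁ refl = ≼⇒upper (subst (λ x → γ 0 ≼ pos x) (sym (κ-even (suc i))) (minimal (suc i)))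
                                (γ-injective 0 (suc i + suc i) z<s t<L)
    ... | i , inj₂ refl with κ-odd i
    ...   | c , e , f = subst (λ x → upper (γ 0) (pos x) ≡ true) (sym e) (center-upper c
            (subst (λ q → γ 0 ≼ pos (inj₁ q)) (sym f) (minimal i))
            (subst (λ q → γ 0 ≼ pos (inj₁ q))
              (trans (iter-suc i p) (trans (cong next (sym f)) (next-child c))) (minimal (suc i))))

    open ClosedCurve (h + h) γ γ-adj (cong pos κ-closed) γ-injective γ-extreme using (self-crossings)

    κ-step : ∀ (P : Vertex m n → Vertex m n → Vertex m n → Set) →
      (∀ c → P (inj₁ (child c)) (inj₂ c) (inj₁ (parent c))) →
      ∀ i → P (κ (i + i)) (κ (suc (i + i))) (κ (2 + (i + i)))
    κ-step P f i with κ-odd i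
    ... | c , e , e′ rewrite κ-even i | e | path-even i (next p) | iter-suc i p | sym e′ | next-child c = f c

    -- The two halves of a diagonal have the same direction, so their sides agree and cancel.
    turns-even : ⨁ L (λ s → upper (γ s) (γ (suc s))) ≡ false
    turns-even = trans (cong (λ l → ⨁ l (λ s → upper (γ s) (γ (suc s)))) (sym double)) (trans
      (⨁-pairs (suc h) _)
      (⨁-zero (suc h) λ i _ → κ-step (λ x y z → upper (pos x) (pos y) xor upper (pos y) (pos z) ≡ false) straight i))
      where
      straight : ∀ c → upper (pos (inj₁ (child c))) (pos (inj₂ c)) xor upper (pos (inj₂ c)) (pos (inj₁ (parent c))) ≡ false
      straight c = diagonal-elim (λ q o q′ → upper q o xor upper o q′ ≡ false) c (corner c) (go (corner c))
        where
        go : ∀ k {u v} → upper (cornerPos u v k) (suc u , suc v) xor upper (suc u , suc v) (cornerPos u v (opp k)) ≡ false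
        go SW {u} {v} rewrite <ᵇ-false {v} ≤-refl | ≡ᵇ-refl v | <ᵇ-false {suc u} {u} (n≤1+n u) = refl
        go NE {u} {v} rewrite <ᵇ-false {v} ≤-refl | ≡ᵇ-refl v | <ᵇ-true {u} {suc u} ≤-refl = refl
        go SE {u} {v} rewrite <ᵇ-false {suc v} {v} (n≤1+n v) | ≡ᵇ-false {suc v} {v} (≢-sym (<⇒≢ ≤-refl)) = refl
        go NW {u} {v} rewrite <ᵇ-true {v} {suc v} ≤-refl = refl

    w : Vertex m n → Bool
    w x = winding L γ (pos x)

    -- `self-crossings` leaves out the last step. That step ends at the extreme base point, hence
    -- points to the lower side and contributes nothing, so the sum equals the even total
    -- `turns-even`.
    on-curve-odd : ⨁ L (w ∘ κ) ≡ true
    on-curve-odd = trans (self-crossings h refl) (cong not last-turn)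
      where
      turn₀ : upper (γ (suc (h + h))) (γ L) ≡ false
      turn₀ = subst (λ q → upper (γ (suc (h + h))) q ≡ false) (sym (cong pos κ-closed))
        (upper-asym (γ 0) (γ (suc (h + h))) (γ-extreme (suc (h + h)) z<s ≤-refl))
      last-turn : ⨁ (suc (h + h)) (λ s → upper (γ s) (γ (suc s))) ≡ false
      last-turn = trans (sym (trans (cong (⨁ (suc (h + h)) (λ s → upper (γ s) (γ (suc s))) xor_) turn₀) (xor-identityʳ _)))
        turns-even

    total-even : ∑₂.∑ (elements (vertexᴱ m n)) w ≡ false
    total-even = begin
      ∑₂.∑ (elements (vertexᴱ m n)) w
        ≡⟨ ∑-⨁-comm (elements (vertexᴱ m n)) L (λ x s → cross (pos x) (γ s) (γ (suc s))) ⟩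
      ⨁ L f
        ≡⟨ trans (cong (λ l → ⨁ l f) (sym double)) (⨁-pairs (suc h) f) ⟩
      ⨁ (suc h) (λ i → f (i + i) xor f (suc (i + i)))
        ≡⟨ ⨁-cong (suc h) (λ i _ → trans
             (κ-step (λ x y z → rays {m} {n} (pos x) (pos y) xor rays {m} {n} (pos y) (pos z) ≡ lv x xor lv z)
               (λ c → rays-diagonal c (corner c)) i)
             (cong₂ _xor_ (cong lv (κ-even i)) (cong lv (path-even i (next p))))) ⟩
      ⨁ (suc h) (λ i → lv (inj₁ (iter i p)) xor lv (inj₁ (iter (suc i) p)))
        ≡⟨ ⨁-telescope (suc h) (λ i → lv (inj₁ (iter i p))) ⟩
      lv (inj₁ p) xor lv (inj₁ (iter (suc h) p))
        ≡⟨ cong (λ q → lv (inj₁ p) xor lv (inj₁ q)) return ⟩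
      lv (inj₁ p) xor lv (inj₁ p)
        ≡⟨ xor-same (lv (inj₁ p)) ⟩
      false ∎
      where
      open ≡-Reasoning
      f : ℕ → Bool
      f s = rays {m} {n} (γ s) (γ (suc s))
      lv : Vertex m n → Bool
      lv x = level (proj₂ (pos x))

    OnCurve : Vertex m n → Set
    OnCurve x = ∃ λ s → s < L × x ≡ κ s

    onCurve? : ∀ x → Dec (OnCurve x)
    onCurve? x = anyUpTo? (λ s → x ≟V κ s) L

    off : ∀ x → ¬ OnCurve x → ∀ s → s ≤ L → pos x ≢ γ s
    off x ¬on s s≤L e with m≤n⇒m<n∨m≡n s≤L
    ... | inj₁ s<L  = ¬on (s , s<L , pos-injective x (κ s) e)
    ... | inj₂ refl = ¬on (0 , z<s , trans (pos-injective x (κ L) e) κ-closed)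

    w-adj : ∀ {x y} → Adj (pos x) (pos y) → ¬ OnCurve x → ¬ OnCurve y → w x ≡ w y
    w-adj {x} {y} a ¬x ¬y = winding-adj L γ γ-adj (cong pos κ-closed) a (off x ¬x) (off y ¬y)

    -- `w` on the curve and `false` elsewhere, written as a sum over curve indices so that
    -- exchanging sums turns its total into the one of `on-curve-odd`.
    restricted : Vertex m n → Bool
    restricted x = ⨁ L (λ s → ∑₂.δ _≟V_ (κ s) (w x) x)

    restricted-on : ∀ x → OnCurve x → restricted x ≡ w x
    restricted-on x (s , s<L , refl) = trans
      (⨁-single L _ s s<L λ t t<L t≢s → ∑₂.δ-diff _≟V_ (κ t) (w x) x λ e → distinct t t<L t≢s e)
      (∑₂.δ-same _≟V_ x (w x))
      where
      distinct : ∀ t → t < L → t ≢ s → κ s ≢ κ t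
      distinct t t<L t≢s e with <-cmp s t
      ... | tri< s<t _ _ = κ-injective s t s<t t<L e
      ... | tri≈ _ s≡t _ = t≢s (sym s≡t)
      ... | tri> _ _ t<s = κ-injective t s t<s s<L (sym e)

    restricted-off : ∀ x → ¬ OnCurve x → restricted x ≡ false
    restricted-off x ¬on = ⨁-zero L λ s s<L → ∑₂.δ-diff _≟V_ (κ s) (w x) x λ e → ¬on (s , s<L , e)

    outer : Vertex m n → Bool
    outer x = w x xor restricted x

    outer-on : ∀ x → OnCurve x → outer x ≡ false
    outer-on x on = trans (cong (w x xor_) (restricted-on x on)) (xor-same (w x))

    outer-off : ∀ x → ¬ OnCurve x → outer x ≡ w x
    outer-off x ¬on = trans (cong (w x xor_) (restricted-off x ¬on)) (xor-identityʳ (w x))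

    outer-odd : ∑₂.∑ (elements (vertexᴱ m n)) outer ≡ true
    outer-odd = begin
      ∑₂.∑ vs outer
        ≡⟨ ∑₂.∑-∙ vs w restricted ⟩
      ∑₂.∑ vs w xor ∑₂.∑ vs restricted
        ≡⟨ cong (_xor ∑₂.∑ vs restricted) total-even ⟩
      ∑₂.∑ vs restricted
        ≡⟨ ∑-⨁-comm vs L (λ x s → ∑₂.δ _≟V_ (κ s) (w x) x) ⟩
      ⨁ L (λ s → ∑₂.∑ vs (λ x → ∑₂.δ _≟V_ (κ s) (w x) x))
        ≡⟨ ⨁-cong L (λ s _ → ∑₂.∑-δ _≟V_ (vertexᴱ m n) (κ s) w) ⟩
      ⨁ L (w ∘ κ)
        ≡⟨ on-curve-odd ⟩
      true ∎
      where
      open ≡-Reasoning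
      vs : List (Vertex m n)
      vs = elements (vertexᴱ m n)

    point-on : ∀ {q} → OnCurve (inj₁ q) → ∃ λ i → iter i p ≡ q × i < suc h
    point-on (s , s<L , e) with halve s
    ... | i , inj₁ refl = i , inj₁-injective (sym (trans e (κ-even i))) , even-bound s<L
    ... | i , inj₂ refl with κ-odd i
    ...   | c , e′ , _ with () ← trans e e′

    center-on : ∀ {c} → OnCurve (inj₂ c) → ∃ λ i → iter i p ≡ child c × i < suc h
    center-on (s , s<L , e) with halve s
    ... | i , inj₁ refl with () ← trans e (κ-even i)
    ... | i , inj₂ refl with κ-odd i
    ...   | c , e′ , f = i , trans (sym f) (cong child (inj₂-injective (sym (trans e e′)))) , odd-bound s<L

    child-on : ∀ {c} i → i < suc h → iter i p ≡ child c → OnCurve (inj₁ (child c))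
    child-on i i< e = i + i , subst (i + i <_) double (+-mono-< i< i<) , sym (trans (κ-even i) (cong inj₁ e))

    child⇒center-on : ∀ {c} i → i < suc h → iter i p ≡ child c → OnCurve (inj₂ c)
    child⇒center-on {c} i i< e with κ-odd i
    ... | c′ , e′ , f = suc (i + i) ,
      subst (_≤ L) (cong suc (+-suc i i)) (subst (suc i + suc i ≤_) double (+-mono-≤ i< i<)) ,
      trans (cong inj₂ (child-injective (trans (sym e) (sym f)))) (sym e′)

    -- A center and its matched point are both on the curve or both off it, since the cycle leaves
    -- every point through the center matched to it. The ends of an impurity are off the curve, and
    -- so is a center adjacent to both, whose winding number they share.
    outer-matched : ∀ e → M e ≡ true → ∑₂.∑ (endsOf e) outer ≡ false
    outer-matched (inj₁ (c , k)) Me with proj₂ (proj₂ (matched c)) Me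
    ... | refl with onCurve? (inj₁ (child c)) | onCurve? (inj₂ c)
    ...   | yes a | yes b rewrite outer-on _ a | outer-on _ b = refl
    ...   | no ¬a | no ¬b rewrite outer-off _ ¬a | outer-off _ ¬b | w-adj (corner-adj c (corner c)) ¬a ¬b
            | xor-identityʳ (w (inj₂ c)) = xor-same (w (inj₂ c))
    ...   | yes a | no ¬b with point-on a
    ...     | i , e , i< = contradiction (child⇒center-on i i< e) ¬b
    outer-matched (inj₁ (c , k)) Me | refl | no ¬a | yes b with center-on b
    ...     | i , e , i< = contradiction (child-on i i< e) ¬a
    outer-matched (inj₂ e) Me with ends-common-center 1≤m 1≤n e
    ... | c , k , k′ , ek , ek′ = begin
      outer x xor (outer y xor false)  ≡⟨ cong (outer x xor_) (xor-identityʳ (outer y)) ⟩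
      outer x xor outer y              ≡⟨ cong₂ _xor_ (outer-off x off-x) (outer-off y off-y) ⟩
      w x xor w y                      ≡⟨ cong₂ _xor_ (w-adj (subst (λ q → Adj (pos (inj₁ q)) (pos (inj₂ c))) (sym ek) (corner-adj c k)) off-x off-c)
                                                      (w-adj (subst (λ q → Adj (pos (inj₁ q)) (pos (inj₂ c))) (sym ek′) (corner-adj c k′)) off-y off-c) ⟩
      w (inj₂ c) xor w (inj₂ c)        ≡⟨ xor-same (w (inj₂ c)) ⟩
      false                            ∎
      where
      open ≡-Reasoning
      x y : Vertex m n
      x = inj₁ (proj₁ (ends e))
      y = inj₁ (proj₂ (ends e))
      off-end : ∀ {q} → IsEnd q e → ∀ i → iter i p ≢ q
      off-end end i refl = NonRoot⇒¬Root (nonroot i) (e , Me , end)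
      off-x : ¬ OnCurve x
      off-x on with point-on on
      ... | i , eq , _ = off-end (inj₁ refl) i eq
      off-y : ¬ OnCurve y
      off-y on with point-on on
      ... | i , eq , _ = off-end (inj₂ refl) i eq
      off-corner : ∀ i → iter i p ≡ child c → ∀ k → IsEnd (cornerPt c k) e → k ≡ corner c ⊎ k ≡ opp (corner c) → ⊥
      off-corner i eq _ end (inj₁ refl) = off-end end i eq
      off-corner i eq _ end (inj₂ refl) = off-end end (suc i) (trans (iter-suc i p) (trans (cong next eq) (next-child c)))
      -- Both corners of c of the class of the cycle are on it, and one of them is x or y.
      off-c : ¬ OnCurve (inj₂ c)
      off-c on with center-on on
      ... | i , eq , _ with cls-dichotomy (cls (cornerPt c k)) (cls (cornerPt c k′)) (cls (child c))
                              (λ same → ends-cls e (trans (cong cls ek) (trans same (cong cls (sym ek′)))))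
      ...   | inj₁ same = off-corner i eq k (inj₁ (sym ek)) (cls-corner c (corner c) k (sym same))
      ...   | inj₂ same = off-corner i eq k′ (inj₂ (sym ek′)) (cls-corner c (corner c) k′ (sym same))

    impossible : ⊥
    impossible with () ← trans (sym outer-odd) (∑-matched outer outer-matched)

  -- Absence of directed cycles

  module _ (1≤m : 1 ≤ m) (1≤n : 1 ≤ n) where

    iter-* : ∀ {d p} → iter d p ≡ p → ∀ q → iter (q * d) p ≡ p
    iter-* e zero    = refl
    iter-* {d} {p} e (suc q) = trans (iter-+ d (q * d) p) (trans (cong (iter (q * d)) e) (iter-* e q))

    -- A repetition within one period would give a shorter period at a point that is not a root,
    -- against the hypothesis; so the cycle is simple. It is restarted at a `≼`-least point to make
    -- the base point extreme.
    nonroot-cycle : ∀ h → (∀ {d} → d < suc h → 0 < d → ∀ p → iter d p ≡ p → Root p) →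
      ∀ p → NonRoot p → iter (suc h) p ≢ p
    nonroot-cycle h shorter p p-nonroot return with ≼-minimum (λ i → pos (inj₁ (iter i p))) h
    ... | t , least = SimpleCycle.impossible 1≤m 1≤n h q q-return q-nonroot q-minimal q-simple
      where
      d : ℕ
      d = suc h
      q : Pt m n
      q = iter t p
      nonroot : ∀ i → NonRoot (iter i p)
      nonroot i with classify (iter i p)
      ... | inj₁ nr = nr
      ... | inj₂ r  = contradiction (subst Root back r) (NonRoot⇒¬Root p-nonroot)
        where
        -- A root on the orbit would be fixed, yet iterating on to `i * d`, a multiple of the
        -- period, leads back to `p`.
        back : iter i p ≡ p
        back = begin
          iter i p                       ≡⟨ iter-root (i * d ∸ i) r ⟨
          iter (i * d ∸ i) (iter i p)    ≡⟨ iter-+ i (i * d ∸ i) p ⟨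
          iter (i + (i * d ∸ i)) p       ≡⟨ cong (λ j → iter j p) (m+[n∸m]≡n (m≤m*n i d)) ⟩
          iter (i * d) p                 ≡⟨ iter-* {d} return i ⟩
          p                              ∎
          where open ≡-Reasoning
      q-nonroot : ∀ i → NonRoot (iter i q)
      q-nonroot i = subst NonRoot (iter-+ t i p) (nonroot (t + i))
      q-return : iter d q ≡ q
      q-return = begin
        iter d (iter t p)  ≡⟨ iter-+ t d p ⟨
        iter (t + d) p     ≡⟨ cong (λ j → iter j p) (+-comm t d) ⟩
        iter (d + t) p     ≡⟨ iter-+ d t p ⟩
        iter t (iter d p)  ≡⟨ cong (iter t) return ⟩
        iter t p           ∎
        where open ≡-Reasoning
      periodic : ∀ s → iter s p ≡ iter (s % d) p
      periodic s = begin
        iter s p                                ≡⟨ cong (λ j → iter j p) (trans (m≡m%n+[m/n]*n s d) (+-comm (s % d) _)) ⟩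
        iter ((s / d) * d + s % d) p            ≡⟨ iter-+ ((s / d) * d) (s % d) p ⟩
        iter (s % d) (iter ((s / d) * d) p)     ≡⟨ cong (iter (s % d)) (iter-* {d} return (s / d)) ⟩
        iter (s % d) p                          ∎
        where open ≡-Reasoning
      q-minimal : ∀ i → pos (inj₁ q) ≼ pos (inj₁ (iter i q))
      q-minimal i = subst (λ r → pos (inj₁ q) ≼ pos (inj₁ r))
        (trans (sym (periodic (t + i))) (iter-+ t i p)) (least ((t + i) % d) (s≤s⁻¹ (m%n<n (t + i) d)))
      q-simple : ∀ i j → i < j → j < d → iter i q ≢ iter j q
      q-simple i j i<j j<d e = NonRoot⇒¬Root (q-nonroot i)
        (shorter (≤-<-trans (m∸n≤m j i) j<d) (m<n⇒0<n∸m i<j) (iter i q)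
          (trans (sym (iter-+ i (j ∸ i) q)) (trans (cong (λ l → iter l q) (m+[n∸m]≡n (<⇒≤ i<j))) (sym e))))

    no-cycle : ∀ d → 0 < d → ∀ p → iter d p ≡ p → Root p
    no-cycle = <-rec _ λ { (suc h) shorter _ p return →
      [ (λ nr → contradiction return (nonroot-cycle h shorter p nr)) , id ]′ (classify p) }

-- Counting points, centers and impurities

open ∑ℕ using (∑; ∑-cong; ∑-∙; ∑-++; ∑-map; ∑-×; ∑-tabulate; ∑-single; double-counting)

∑-allFin : ∀ {n} (f : Fin n → ℕ) → ∑ (allFin n) f ≡ sumFin f
∑-allFin {zero}  f = refl
∑-allFin {suc n} f = cong (f zero +_) (trans (∑-tabulate suc f) (∑-allFin (f ∘ suc)))

∑-const : ∀ n c → ∑ (allFin n) (λ _ → c) ≡ n * c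
∑-const zero    c = refl
∑-const (suc n) c = cong (c +_) (trans (∑-tabulate {n = n} suc (λ _ → c)) (∑-const n c))

∑-ind : ∀ {A : Set} (xs : List A) (b : A → Bool) → length (filter (λ x → b x Bool.≟ true) xs) ≡ ∑ xs (ind ∘ b)
∑-ind []       b = refl
∑-ind (x ∷ xs) b with b x
... | true  = cong suc (∑-ind xs b)
... | false = ∑-ind xs b

∑-full : ∀ {A : Set} (xs : List A) (f : A → ℕ) → (∀ x → f x ≤ 1) → ∑ xs (λ _ → 1) ≤ ∑ xs f → ∀ {x} → x ∈ xs → f x ≡ 1
∑-full {A} (y ∷ xs) f bound full (here refl) = ≤-antisym (bound y)
  (+-cancelʳ-≤ (∑ xs f) 1 (f y) (≤-trans (s≤s (upper-bound xs)) full))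
  where
  upper-bound : ∀ xs → ∑ xs f ≤ ∑ xs (λ _ → 1)
  upper-bound []       = z≤n
  upper-bound (x ∷ xs) = +-mono-≤ (bound x) (upper-bound xs)
∑-full (y ∷ xs) f bound full (there x∈) = ∑-full xs f bound
  (+-cancelˡ-≤ 1 _ _ (≤-trans full (+-monoˡ-≤ (∑ xs f) (bound y)))) x∈

module _ {m n : ℕ} where

  ∑-countE2 : ∀ (I : E2 m n → Bool) → ∑ (elements (e2ᴱ m n)) (ind ∘ I) ≡ countE2 I
  ∑-countE2 I = trans (∑-++ (map (uncurry hor) hs) _ (ind ∘ I)) (cong₂ _+_
    (trans (∑-map (uncurry hor) hs (ind ∘ I)) (nested m (suc n) (ind ∘ I ∘ uncurry hor)))
    (trans (∑-map (uncurry ver) vs (ind ∘ I)) (nested (suc m) n (ind ∘ I ∘ uncurry ver))))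
    where
    hs : List (Fin m × Fin (suc n))
    hs = elements (finᴱ m ×ᴱ finᴱ (suc n))
    vs : List (Fin (suc m) × Fin n)
    vs = elements (finᴱ (suc m) ×ᴱ finᴱ n)
    nested : ∀ a b (f : Fin a × Fin b → ℕ) →
      ∑ (elements (finᴱ a ×ᴱ finᴱ b)) f ≡ sumFin (λ x → sumFin (λ y → f (x , y)))
    nested a b f = trans (∑-× (allFin a) (allFin b) f) (trans
      (∑-cong (allFin a) λ x → ∑-allFin (λ y → f (x , y))) (∑-allFin {a} _))

  degree : (Edge m n → Bool) → Ctr m n → ℕ
  degree M c = ∑ (elements cornerᴱ) (λ k → ind (M (inj₁ (c , k))))

  ptEnds : Edge m n → List (Pt m n)
  ptEnds (inj₁ (c , k)) = cornerPt c k ∷ []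
  ptEnds (inj₂ e)       = proj₁ (ends e) ∷ proj₂ (ends e) ∷ []

  ptEnds-unique : ∀ e → Unique (ptEnds e)
  ptEnds-unique (inj₁ _) = [] ∷ []
  ptEnds-unique (inj₂ e) = ((λ eq → ends-cls e (cong cls eq)) ∷ []) ∷ [] ∷ []

  Incident⇒∈pt : ∀ p e → Incident (inj₁ p) e → p ∈ ptEnds e
  Incident⇒∈pt p (inj₁ _) (inj₁ refl) = here refl
  Incident⇒∈pt p (inj₂ _) (inj₁ refl) = here refl
  Incident⇒∈pt p (inj₂ _) (inj₂ refl) = there (here refl)

  ∈pt⇒Incident : ∀ p e → p ∈ ptEnds e → Incident (inj₁ p) e
  ∈pt⇒Incident p (inj₁ _) (here refl) = inj₁ refl
  ∈pt⇒Incident p (inj₂ _) (here refl) = inj₁ refl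
  ∈pt⇒Incident p (inj₂ _) (there (here refl)) = inj₂ refl

  -- Serves both directions. When all centers have degree one it yields the number of impurities;
  -- when that number is `k` it yields the total degree of the centers.
  count-points : (M : Edge m n → Bool) →
    (∀ p → ∃ λ e → (M e ≡ true × Incident (inj₁ p) e) × (∀ {e′} → M e′ ≡ true × Incident (inj₁ p) e′ → e ≡ e′)) →
    suc m * suc n ≡ ∑ (elements (ctrᴱ m n)) (degree M) + (countE2 (M ∘ inj₂) + countE2 (M ∘ inj₂))
  count-points M matched = begin
    suc m * suc n
      ≡⟨ cong (suc m *_) (sym (*-identityʳ (suc n))) ⟩
    suc m * (suc n * 1)
      ≡⟨ ∑-const (suc m) (suc n * 1) ⟨
    ∑ (allFin (suc m)) (λ _ → suc n * 1)
      ≡⟨ ∑-cong (allFin (suc m)) (λ _ → ∑-const (suc n) 1) ⟨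
    ∑ (allFin (suc m)) (λ _ → ∑ (allFin (suc n)) (λ _ → 1))
      ≡⟨ ∑-× (allFin (suc m)) (allFin (suc n)) (λ _ → 1) ⟨
    ∑ (elements (ptᴱ m n)) (λ _ → 1)
      ≡⟨ double-counting _≟P_ (ptᴱ m n) (edgeᴱ m n) M ptEnds ptEnds-unique incidence (λ _ → 1) ⟩
    ∑ (elements (edgeᴱ m n)) term
      ≡⟨ ∑-++ (map inj₁ (elements (e1ᴱ m n))) _ term ⟩
    ∑ (map inj₁ (elements (e1ᴱ m n))) term + ∑ (map inj₂ (elements (e2ᴱ m n))) term
      ≡⟨ cong₂ _+_ (∑-map inj₁ (elements (e1ᴱ m n)) term) (∑-map inj₂ (elements (e2ᴱ m n)) term) ⟩
    ∑ (elements (e1ᴱ m n)) (term ∘ inj₁) + ∑ (elements (e2ᴱ m n)) (term ∘ inj₂)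
      ≡⟨ cong₂ _+_ (∑-× (elements (ctrᴱ m n)) (elements cornerᴱ) (term ∘ inj₁))
           (trans (∑-cong (elements (e2ᴱ m n)) λ e → two-ends (M (inj₂ e)))
             (∑-∙ (elements (e2ᴱ m n)) (ind ∘ M ∘ inj₂) (ind ∘ M ∘ inj₂))) ⟩
    ∑ (elements (ctrᴱ m n)) (degree M) + (∑ (elements (e2ᴱ m n)) (ind ∘ M ∘ inj₂) + ∑ (elements (e2ᴱ m n)) (ind ∘ M ∘ inj₂))
      ≡⟨ cong (λ z → ∑ (elements (ctrᴱ m n)) (degree M) + (z + z)) (∑-countE2 (M ∘ inj₂)) ⟩
    ∑ (elements (ctrᴱ m n)) (degree M) + (countE2 (M ∘ inj₂) + countE2 (M ∘ inj₂)) ∎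
    where
    open ≡-Reasoning
    term : Edge m n → ℕ
    term e = if M e then ∑ (ptEnds e) (λ _ → 1) else 0
    two-ends : ∀ b → (if b then 2 else 0) ≡ ind b + ind b
    two-ends true  = refl
    two-ends false = refl
    incidence : ∀ p → ∃ λ e → (M e ≡ true × p ∈ ptEnds e) × (∀ {e′} → M e′ ≡ true × p ∈ ptEnds e′ → e ≡ e′)
    incidence p with matched p
    ... | e , (Me , i) , only = e , (Me , Incident⇒∈pt p e i) , λ {e′} (Me′ , i′) → only (Me′ , ∈pt⇒Incident p e′ i′)

  ∑-ctrs-one : ∑ (elements (ctrᴱ m n)) (λ _ → 1) ≡ m * n
  ∑-ctrs-one = trans (∑-× (allFin m) (allFin n) (λ _ → 1)) (trans
    (∑-cong (allFin m) λ _ → trans (∑-const n 1) (*-identityʳ n)) (∑-const m n))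

  degree-one : ∀ M c {k} → M (inj₁ (c , k)) ≡ true → (∀ {k′} → M (inj₁ (c , k′)) ≡ true → k ≡ k′) → degree M c ≡ 1
  degree-one M c {k} Mk only = trans
    (∑-single (unique cornerᴱ) (complete cornerᴱ k) (λ k′ → ind (M (inj₁ (c , k′)))) other)
    (cong ind Mk)
    where
    other : ∀ k′ → k′ ≢ k → ind (M (inj₁ (c , k′))) ≡ 0
    other k′ k′≢k with M (inj₁ (c , k′)) in e
    ... | true  = contradiction (sym (only e)) k′≢k
    ... | false = refl

  grid-size : ∀ k → m + n + 1 ≡ 2 * k → suc m * suc n ≡ m * n + (k + k)
  grid-size k e = begin
    suc n + m * suc n    ≡⟨ cong (suc n +_) (*-suc m n) ⟩
    suc n + (m + m * n)  ≡⟨ +-assoc (suc n) m (m * n) ⟨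
    (suc n + m) + m * n  ≡⟨ +-comm (suc n + m) (m * n) ⟩
    m * n + (suc n + m)  ≡⟨ cong (m * n +_) (trans (cong suc (+-comm n m)) (trans (+-comm 1 (m + n)) (trans e (cong (k +_) (+-identityʳ k))))) ⟩
    m * n + (k + k)      ∎
    where open ≡-Reasoning

-- Auxiliary facts on lists, classes and connectedness

double-injective : ∀ {a b} → a + a ≡ b + b → a ≡ b
double-injective {a} {b} e = *-cancelˡ-≡ a b 2
  (trans (cong (a +_) (+-identityʳ a)) (trans e (cong (b +_) (sym (+-identityʳ b)))))

lookup-injective : ∀ {A : Set} {xs : List A} → Unique xs → ∀ i j → lookup xs i ≡ lookup xs j → i ≡ j
lookup-injective {xs = _ ∷ _} u zero    zero    e = refl
lookup-injective {xs = _ ∷ xs} u zero   (suc j) e = contradiction (subst (_∈ xs) (sym e) (∈-lookup j)) (Unique[x∷xs]⇒x∉xs u)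
lookup-injective {xs = _ ∷ xs} u (suc i) zero   e = contradiction (subst (_∈ xs) e (∈-lookup i)) (Unique[x∷xs]⇒x∉xs u)
lookup-injective {xs = _ ∷ _} (_ ∷ u) (suc i) (suc j) e = cong suc (lookup-injective u i j e)

argmax : ∀ {n} (f : Fin (suc n) → ℕ) → ∃ λ i → ∀ j → f j ≤ f i
argmax {zero}  f = zero , λ { zero → ≤-refl }
argmax {suc n} f with argmax (f ∘ suc)
... | i , max with ≤-total (f zero) (f (suc i))
...   | inj₁ le = suc i , λ { zero → le ; (suc j) → max j }
...   | inj₂ ge = zero  , λ { zero → ≤-refl ; (suc j) → ≤-trans (max j) ge }

_==_ : Cls → Cls → Bool
one == one = true
one == two = false
two == one = false
two == two = true

==-refl : ∀ j → (j == j) ≡ true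
==-refl one = refl
==-refl two = refl

==⇒≡ : ∀ {i j} → (i == j) ≡ true → i ≡ j
==⇒≡ {one} {one} _ = refl
==⇒≡ {two} {two} _ = refl

module _ {m n : ℕ} where

  IsEnd-unique : ∀ {p q} (e : E2 m n) → IsEnd p e → IsEnd q e → cls p ≡ cls q → p ≡ q
  IsEnd-unique e (inj₁ refl) (inj₁ refl) _ = refl
  IsEnd-unique e (inj₂ refl) (inj₂ refl) _ = refl
  IsEnd-unique e (inj₁ refl) (inj₂ refl) c = contradiction c (ends-cls e)
  IsEnd-unique e (inj₂ refl) (inj₁ refl) c = contradiction (sym c) (ends-cls e)

  end-of-class : ∀ j (e : E2 m n) → ∃ λ q → IsEnd q e × cls q ≡ j
  end-of-class j e with cls-dichotomy _ _ j (ends-cls e)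
  ... | inj₁ c = _ , inj₁ refl , c
  ... | inj₂ c = _ , inj₂ refl , c

  FAdj-sym : ∀ {j F} {p q : Pt m n} → FAdj j F p q → FAdj j F q p
  FAdj-sym (c , Fc , a , b , ne , vp , vq) = c , Fc , b , a , ne ∘ sym , vq , vp

  Connected-sym : ∀ {j F} {p q : Pt m n} → Connected j F p q → Connected j F q p
  Connected-sym = reverse FAdj-sym

-- The two forests of a dimer covering

module DimerForest {m n : ℕ} (M : Edge m n → Bool) (D : IsDimer M)
  (N : ℕ) (settled : ∀ p → Matching.Root M D (Matching.iter M D N p)) where

  open Matching M D

  root : Pt m n → Pt m n
  root = iter N

  root-next : ∀ p → root (next p) ≡ root p
  root-next p = trans (iter-suc N p) (next-root (settled p))

  root-root : ∀ {p} → Root p → root p ≡ p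
  root-root = iter-root N

  -- The number of steps to the root, computed with bounded fuel; by `depth-stable` one more unit of
  -- fuel changes nothing once the root is within reach.
  depth : ℕ → Pt m n → ℕ
  depth zero    p = 0
  depth (suc i) p = [ (λ _ → suc (depth i (next p))) , (λ _ → 0) ]′ (classify p)

  depth-nonroot : ∀ i {p} → NonRoot p → depth (suc i) p ≡ suc (depth i (next p))
  depth-nonroot i {p} nr = go (classify p)
    where
    go : (x : NonRoot p ⊎ Root p) → [ (λ _ → suc (depth i (next p))) , (λ _ → 0) ]′ x ≡ suc (depth i (next p))
    go (inj₁ _) = refl
    go (inj₂ r) = contradiction r (NonRoot⇒¬Root nr)

  depth-root : ∀ i {p} → Root p → depth i p ≡ 0
  depth-root zero        r = refl
  depth-root (suc i) {p} r = go (classify p)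
    where
    go : (x : NonRoot p ⊎ Root p) → [ (λ _ → suc (depth i (next p))) , (λ _ → 0) ]′ x ≡ 0
    go (inj₁ nr) = contradiction r (NonRoot⇒¬Root nr)
    go (inj₂ _)  = refl

  depth-stable : ∀ i p → Root (iter i p) → depth (suc i) p ≡ depth i p
  depth-stable zero    p r = depth-root 1 r
  depth-stable (suc i) p r = go (classify p)
    where
    go : NonRoot p ⊎ Root p → depth (2 + i) p ≡ depth (suc i) p
    go (inj₂ r′) = trans (depth-root (2 + i) r′) (sym (depth-root (suc i) r′))
    go (inj₁ nr) = trans (depth-nonroot (suc i) nr) (trans (cong suc (depth-stable i (next p) r)) (sym (depth-nonroot i nr)))

  rank : Pt m n → ℕ
  rank = depth (suc N)

  rank-child : ∀ c → rank (parent c) < rank (child c)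
  rank-child c = ≤-reflexive (sym (trans (depth-nonroot N (c , refl))
    (cong suc (trans (sym (depth-stable N (next (child c)) (settled (next (child c))))) (cong rank (next-child c))))))

  Forest : Cls → Ctr m n → Bool
  Forest j c = cls (child c) == j

  Impurity : E2 m n → Bool
  Impurity e = M (inj₂ e)

  Link : Pt m n → Pt m n → Set
  Link p q = ∃ λ c → child c ≡ p × parent c ≡ q

  adj⇒link : ∀ {j p q} → FAdj j (Forest j) p q → Link p q ⊎ Link q p
  adj⇒link {j} (c , Fc , (k , refl) , (k′ , refl) , ne , vp , vq)
    with cls-corner c k k′ (trans (InV⇒cls j _ vp) (sym (InV⇒cls j _ vq)))
       | cls-corner c k (corner c) (trans (InV⇒cls j _ vp) (sym (==⇒≡ Fc)))
  ... | inj₁ refl | _         = contradiction refl ne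
  ... | inj₂ refl | inj₁ e    = inj₁ (c , cong (cornerPt c) e , cong (cornerPt c ∘ opp) e)
  ... | inj₂ refl | inj₂ e    = inj₂ (c , cong (cornerPt c) e , cong (cornerPt c) (trans (cong opp e) (opp-involutive k)))

  link⇒adj : ∀ c → FAdj (cls (child c)) (Forest (cls (child c))) (child c) (parent c)
  link⇒adj c = c , ==-refl _ , (corner c , refl) , (opp (corner c) , refl) ,
    (λ e → opp-≢ (corner c) (cornerPt-injective c _ _ e)) ,
    InV-cls (child c) , cls⇒InV (parent c) (cls-opp c (corner c))

  root-link : ∀ {p q} → Link p q → root p ≡ root q
  root-link (c , refl , refl) = trans (sym (root-next (child c))) (cong root (next-child c))

  root-connected : ∀ {j p q} → Connected j (Forest j) p q → root p ≡ root q
  root-connected ε = refl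
  root-connected (a ◅ as) = trans ([ root-link , sym ∘ root-link ]′ (adj⇒link a)) (root-connected as)

  cls-next : ∀ p → cls (next p) ≡ cls p
  cls-next p with classify p
  ... | inj₁ (c , refl) = cls-opp c (corner c)
  ... | inj₂ _          = refl

  cls-iter : ∀ i p → cls (iter i p) ≡ cls p
  cls-iter zero    p = refl
  cls-iter (suc i) p = trans (cls-iter i (next p)) (cls-next p)

  connected-next : ∀ p → Connected (cls p) (Forest (cls p)) p (next p)
  connected-next p with classify p
  ... | inj₁ (c , refl) = link⇒adj c ◅ ε
  ... | inj₂ _          = ε

  connected-iter : ∀ {j} i p → cls p ≡ j → Connected j (Forest j) p (iter i p)
  connected-iter zero    p refl = ε
  connected-iter (suc i) p refl = connected-next p ◅◅ connected-iter i (next p) (cls-next p)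

  -- Every edge joins a point to its `next`, of smaller rank. At a point of maximal rank on a cycle
  -- both neighbours would therefore be its `next`, although they are distinct. The three cases are
  -- the last, the initial and an inner position, which differ in where the closing edge enters.
  acyclic : ∀ j → Acyclic (FAdj j (Forest j))
  acyclic j ℓ v inj along close with argmax (rank ∘ v)
  ... | i , max = two-neighbours i max
    where
    Next : Fin (3 + ℓ) → Fin (3 + ℓ) → Set
    Next i a = next (v i) ≡ v a
    towards : ∀ i → (∀ a → rank (v a) ≤ rank (v i)) → ∀ a → Link (v i) (v a) ⊎ Link (v a) (v i) → Next i a
    towards i max a (inj₁ (c , e , f)) = trans (cong next (sym e)) (trans (next-child c) f)
    towards i max a (inj₂ (c , e , f)) = contradiction (subst₂ _<_ (cong rank f) (cong rank e) (rank-child c)) (≤⇒≯ (max a))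
    collide : ∀ i a b → Next i a → Next i b → a ≢ b → ⊥
    collide i a b x y ne = ne (inj a b (trans (sym x) y))
    two-neighbours : ∀ i → (∀ a → rank (v a) ≤ rank (v i)) → ⊥
    two-neighbours i max with view i
    ... | ‵fromℕ = collide _ _ zero
            (towards _ max _ (swap (adj⇒link (along (fromℕ (suc ℓ))))))
            (towards _ max zero (adj⇒link close)) λ ()
    ... | ‵inject₁ zero = collide zero (suc zero) (fromℕ (2 + ℓ))
            (towards _ max _ (adj⇒link (along zero)))
            (towards _ max _ (swap (adj⇒link close))) λ ()
    ... | ‵inject₁ (suc l) = collide _ (suc (suc l)) (inject₁ (inject₁ l))
            (towards _ max _ (adj⇒link (along (suc l))))
            (towards _ max _ (swap (adj⇒link (along (inject₁ l)))))
            λ e → contradiction (sym (trans (cong toℕ e) (trans (toℕ-inject₁ (inject₁ l)) (toℕ-inject₁ l)))) (<⇒≢ (n≤1+n _))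

  impurities : List (E2 m n)
  impurities = filter (λ e → Impurity e Bool.≟ true) (elements (e2ᴱ m n))

  rootEdge : Pt m n → E2 m n
  rootEdge p = proj₁ (settled p)

  rootEdge-∈ : ∀ p → rootEdge p ∈ impurities
  rootEdge-∈ p = ∈-filter⁺ (λ e → Impurity e Bool.≟ true) (complete (e2ᴱ m n) (rootEdge p)) (proj₁ (proj₂ (settled p)))

  rootEdge-root : ∀ {p e} → Impurity e ≡ true → IsEnd p e → rootEdge p ≡ e
  rootEdge-root {p} {e} Ie end with settled p | root-root (e , Ie , end)
  ... | e′ , Ie′ , end′ | eq = root-edge-unique Ie′ (subst (λ q → IsEnd q e′) eq end′) Ie end

  rootEdge-connected : ∀ {j} p q → cls p ≡ j → cls q ≡ j → rootEdge p ≡ rootEdge q → Connected j (Forest j) p q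
  rootEdge-connected {j} p q cp cq e = connected-iter N p cp ◅◅
    subst (λ r → Connected j (Forest j) r q) (sym same-root) (Connected-sym (connected-iter N q cq))
    where
    same-root : root p ≡ root q
    same-root = IsEnd-unique (rootEdge q)
      (subst (IsEnd (root p)) e (proj₂ (proj₂ (settled p)))) (proj₂ (proj₂ (settled q)))
      (trans (cls-iter N p) (trans cp (sym (trans (cls-iter N q) cq))))

  -- A tree is labelled by the position of its root's impurity in the list. Each impurity has one
  -- end in each class, so the same labels serve both forests.
  components : ∀ j → HasComponents j (Forest j) (length impurities)
  components j = f , onto , λ (p , vp) (q , vq) →
    (λ e → rootEdge-connected p q (InV⇒cls j p vp) (InV⇒cls j q vq) (f-injective p q e)) ,
    (λ con → f-cong p q (root-connected con))
    where
    f : VSet m n j → Fin (length impurities)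
    f (p , _) = index (rootEdge-∈ p)
    f-injective : ∀ p q → index (rootEdge-∈ p) ≡ index (rootEdge-∈ q) → rootEdge p ≡ rootEdge q
    f-injective p q e = trans (lookup-index (rootEdge-∈ p)) (trans (cong (lookup impurities) e) (sym (lookup-index (rootEdge-∈ q))))
    unique-imps : Unique impurities
    unique-imps = filter⁺ (λ e → Impurity e Bool.≟ true) (unique (e2ᴱ m n))
    f-cong : ∀ p q → root p ≡ root q → index (rootEdge-∈ p) ≡ index (rootEdge-∈ q)
    f-cong p q e = lookup-injective unique-imps _ _
      (trans (sym (lookup-index (rootEdge-∈ p))) (trans same (lookup-index (rootEdge-∈ q))))
      where
      same : rootEdge p ≡ rootEdge q
      same with settled p | settled q
      ... | e₁ , I₁ , end₁ | e₂ , I₂ , end₂ = root-edge-unique I₁ (subst (λ r → IsEnd r e₁) e end₁) I₂ end₂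
    onto : ∀ i → ∃ λ p → f p ≡ i
    onto i with end-of-class j (lookup impurities i)
    ... | q , end , cq = (q , cls⇒InV q cq) , lookup-injective unique-imps _ _
      (trans (sym (lookup-index (rootEdge-∈ q)))
        (rootEdge-root (proj₂ (∈-filter⁻ (λ e → Impurity e Bool.≟ true) {xs = elements (e2ᴱ m n)} (∈-lookup i))) end))

  one-impurity : ∀ j p → InV j p → OneImpurity j (Forest j) Impurity p
  one-impurity j p vp = rootEdge p ,
    (proj₁ (proj₂ (settled p)) , root p , proj₂ (proj₂ (settled p)) ,
      cls⇒InV (root p) (trans (cls-iter N p) (InV⇒cls j p vp)) , Connected-sym (connected-iter N p (InV⇒cls j p vp))) ,
    λ {e} (Ie , q , end , vq , con) → root-edge-unique (proj₁ (proj₂ (settled p)))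
      (proj₂ (proj₂ (settled p))) Ie
      (subst (λ r → IsEnd r e) (trans (sym (root-root (e , Ie , end))) (root-connected con)) end)

  impurity-count : ∀ k → m + n + 1 ≡ 2 * k → countE2 Impurity ≡ k
  impurity-count k e = double-injective (+-cancelˡ-≡ (m * n) _ _ (trans (sym
    (trans (count-points M λ p → D (inj₁ p)) (cong (_+ (countE2 Impurity + countE2 Impurity)) (trans
      (∑ℕ.∑-cong (elements (ctrᴱ m n)) λ c →
        degree-one M c (proj₁ (proj₂ (matched c))) (proj₂ (proj₂ (matched c))))
      (∑-ctrs-one {m} {n}))))) (grid-size {m} {n} k e)))

  isTriple : ∀ k → m + n + 1 ≡ 2 * k → IsTriple k (Forest one) (Forest two) Impurity
  isTriple k e =
    (acyclic one , subst (HasComponents one (Forest one)) number (components one)) ,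
    (acyclic two , subst (HasComponents two (Forest two)) number (components two)) ,
    impurity-count k e ,
    (λ c (F₁c , F₂c) → case trans (sym (==⇒≡ F₁c)) (==⇒≡ F₂c) of λ ()) ,
    one-impurity one , one-impurity two
    where
    number : length impurities ≡ k
    number = trans (∑-ind (elements (e2ᴱ m n)) Impurity) (trans (∑-countE2 Impurity) (impurity-count k e))

code : ∀ {m n} → Pt m n → Fin (suc m * suc n)
code (x , y) = combine x y

code-injective : ∀ {m n} {p q : Pt m n} → code p ≡ code q → p ≡ q
code-injective {p = x , y} {q = x′ , y′} e with combine-injective x y x′ y′ e
... | ex , ey = cong₂ _,_ ex ey

module _ {m n : ℕ} (1≤m : 1 ≤ m) (1≤n : 1 ≤ n) (M : Edge m n → Bool) (D : IsDimer M) where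

  open Matching M D

  -- Two of the iterates up to `N`, the number of points, coincide; the earlier one lies on a cycle,
  -- so it is a root and the orbit has stopped there.
  settles : ∀ N → N ≡ suc m * suc n → ∀ p → Root (iter N p)
  settles N refl p with pigeonhole ≤-refl (λ i → code (iter (toℕ i) p))
  ... | i , j , i<j , e = subst Root stable root-i
    where
    root-i : Root (iter (toℕ i) p)
    root-i = no-cycle 1≤m 1≤n (toℕ j ∸ toℕ i) (m<n⇒0<n∸m i<j) (iter (toℕ i) p)
      (trans (sym (iter-+ (toℕ i) _ p)) (trans (cong (λ l → iter l p) (m+[n∸m]≡n (<⇒≤ i<j))) (sym (code-injective e))))
    stable : iter (toℕ i) p ≡ iter N p
    stable = trans (sym (iter-root (N ∸ toℕ i) root-i)) (trans (sym (iter-+ (toℕ i) _ p))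
      (cong (λ l → iter l p) (m+[n∸m]≡n (s≤s⁻¹ (toℕ<n i)))))

-- Finite search and least witnesses

search : ∀ {A : Set} → Enumeration A → {P : A → Set} → Decidable P → Dec (∃ P)
search 𝔸 P? = map′ (λ a → let (x , _ , Px) = find a in x , Px) (λ (x , Px) → lose (complete 𝔸 x) Px)
  (any? P? (elements 𝔸))

least : ∀ {P : ℕ → Set} → Decidable P → ∀ i → P i → ∃ λ j → P j × (∀ {k} → P k → j ≤ k)
least {P} P? = <-rec _ step
  where
  step : ∀ i → (∀ {j} → j < i → P j → ∃ λ j → P j × (∀ {k} → P k → j ≤ k)) → P i → ∃ λ j → P j × (∀ {k} → P k → j ≤ k)
  step i smaller Pi with anyUpTo? P? i
  ... | yes (j , j<i , Pj) = smaller j<i Pj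
  ... | no none = i , Pi , λ {k} Pk → ≮⇒≥ λ k<i → none (k , k<i , Pk)

does-true : ∀ {P : Set} (P? : Dec P) → does P? ≡ true → P
does-true (yes p) _ = p

Bool-≡ : ∀ {a b : Bool} → (a ≡ true → b ≡ true) → (b ≡ true → a ≡ true) → a ≡ b
Bool-≡ {true}  f g = sym (f refl)
Bool-≡ {false} {false} f g = refl
Bool-≡ {false} {true}  f g = g refl

-- From a triple to a dimer covering

module FromTriple {m n k : ℕ} (size : m + n + 1 ≡ 2 * k)
  (F : Cls → Ctr m n → Bool) (I : E2 m n → Bool) (count : countE2 I ≡ k)
  (disjoint : P1 (F one) (F two)) (paired : ∀ p → OneImpurity (cls p) (F (cls p)) I p)
  where

  Root : Pt m n → Set
  Root p = ∃ λ e → I e ≡ true × IsEnd p e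

  root? : Decidable Root
  root? p = search (e2ᴱ m n) λ e → (I e Bool.≟ true) ×-dec ((p ≟P _) ⊎-dec (p ≟P _))

  root-edge-unique : ∀ {p e e′} → I e ≡ true → IsEnd p e → I e′ ≡ true → IsEnd p e′ → e ≡ e′
  root-edge-unique {p} Ie end Ie′ end′ with paired p
  ... | _ , _ , only = trans (sym (only (Ie , p , end , InV-cls p , ε))) (only (Ie′ , p , end′ , InV-cls p , ε))

  F-disjoint : ∀ {j j′} c → F j c ≡ true → F j′ c ≡ true → j ≡ j′
  F-disjoint {one} {one} c _ _ = refl
  F-disjoint {two} {two} c _ _ = refl
  F-disjoint {one} {two} c x y = contradiction (x , y) (disjoint c)
  F-disjoint {two} {one} c x y = contradiction (y , x) (disjoint c)

  -- A walk of given length through the forest to an impurity. Recursion on the length makes it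
  -- decidable by finite search, so a least length can be extracted.
  Reach : ℕ → Pt m n → Set
  Reach zero    p = Root p
  Reach (suc i) p = ∃ λ c → ∃ λ k → F (cls p) c ≡ true × cornerPt c k ≡ p × Reach i (cornerPt c (opp k))

  reach? : ∀ i → Decidable (Reach i)
  reach? zero    p = root? p
  reach? (suc i) p = search (ctrᴱ m n) λ c → search cornerᴱ λ k →
    (F (cls p) c Bool.≟ true) ×-dec ((cornerPt c k ≟P p) ×-dec reach? i (cornerPt c (opp k)))

  connected-reach : ∀ {j p q} → Connected j (F j) p q → Root q → ∃ λ i → Reach i p
  connected-reach ε r = 0 , r
  connected-reach {j} ((c , Fc , (k , refl) , (k′ , refl) , ne , vp , vq) ◅ con) r
    with cls-corner c k k′ (trans (InV⇒cls j _ vp) (sym (InV⇒cls j _ vq))) | connected-reach con r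
  ... | inj₁ refl | _      = contradiction refl ne
  ... | inj₂ refl | i , ri = suc i , c , k , subst (λ j → F j c ≡ true) (sym (InV⇒cls j _ vp)) Fc , refl , ri

  reachable : ∀ p → ∃ λ i → Reach i p
  reachable p with paired p
  ... | e , (Ie , q , end , _ , con) , _ = connected-reach (Connected-sym con) (e , Ie , end)

  shortest : ∀ p → ∃ λ i → Reach i p × (∀ {k} → Reach k p → i ≤ k)
  shortest p = least (λ i → reach? i p) (proj₁ (reachable p)) (proj₂ (reachable p))

  dist : Pt m n → ℕ
  dist p = proj₁ (shortest p)

  Up : Pt m n → Ctr m n → Set
  Up p c = ∃ λ k → F (cls p) c ≡ true × cornerPt c k ≡ p × dist (cornerPt c (opp k)) < dist p

  up : ∀ p → ¬ Root p → ∃ (Up p)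
  up p ¬r = go (dist p) refl (proj₁ (proj₂ (shortest p)))
    where
    go : ∀ d → d ≡ dist p → Reach d p → ∃ (Up p)
    go zero    _ r = contradiction r ¬r
    go (suc i) e (c , k , Fc , ck , ri) = c , k , Fc , ck ,
      subst (dist (cornerPt c (opp k)) <_) e (s≤s (proj₂ (proj₂ (shortest (cornerPt c (opp k)))) ri))

  parentCtr : Pt m n → Maybe (Ctr m n)
  parentCtr p with root? p
  ... | yes _ = nothing
  ... | no ¬r = just (proj₁ (up p ¬r))

  parentCtr-up : ∀ {p c} → parentCtr p ≡ just c → Up p c
  parentCtr-up {p} e with root? p
  parentCtr-up {p} () | yes _
  parentCtr-up {p} refl | no ¬r = proj₂ (up p ¬r)

  parentCtr-root : ∀ {p c} → Root p → parentCtr p ≢ just c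
  parentCtr-root {p} r e with root? p
  parentCtr-root {p} r () | yes _
  parentCtr-root {p} r e  | no ¬r = ¬r r

  parentCtr-nonroot : ∀ {p} → ¬ Root p → ∃ λ c → parentCtr p ≡ just c
  parentCtr-nonroot {p} ¬r with root? p
  ... | yes r = contradiction r ¬r
  ... | no _  = _ , refl

  parent? : ∀ c k → Dec (parentCtr (cornerPt c k) ≡ just c)
  parent? c k = Maybe-≡-dec _≟C_ (parentCtr (cornerPt c k)) (just c)

  M : Edge m n → Bool
  M (inj₁ (c , k)) = does (parent? c k)
  M (inj₂ e)       = I e

  point-matched : ∀ p → ∃ λ e → (M e ≡ true × Incident (inj₁ p) e) × (∀ {e′} → M e′ ≡ true × Incident (inj₁ p) e′ → e ≡ e′)
  point-matched p with root? p
  ... | yes (e , Ie , end) = inj₂ e , (Ie , IsEnd⇒Incident {e = e} end) , only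
    where
    only : ∀ {e′} → M e′ ≡ true × Incident (inj₁ p) e′ → inj₂ e ≡ e′
    only {inj₁ (c , k)} (Me′ , inj₁ refl) = contradiction (does-true (parent? c k) Me′) (parentCtr-root (e , Ie , end))
    only {inj₂ e′} (Ie′ , i) = cong inj₂ (root-edge-unique Ie end Ie′ (Incident⇒IsEnd {e = e′} i))
  ... | no ¬r with parentCtr-nonroot ¬r
  ...   | c , e with parentCtr-up e
  ...     | k , _ , refl , _ = inj₁ (c , k) , (dec-true (parent? c k) e , inj₁ refl) , only
    where
    only : ∀ {e′} → M e′ ≡ true × Incident (inj₁ p) e′ → inj₁ (c , k) ≡ e′
    only {inj₂ e′} (Ie′ , i) = contradiction (e′ , Ie′ , Incident⇒IsEnd {e = e′} i) ¬r
    only {inj₁ (c′ , k′)} (Me′ , inj₁ i)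
      with refl ← just-injective (trans (sym e) (trans (cong parentCtr (inj₁-injective i)) (does-true (parent? c′ k′) Me′)))
      = cong (λ k → inj₁ (c , k)) (cornerPt-injective c k k′ (inj₁-injective i))

  up-corner : ∀ c k → M (inj₁ (c , k)) ≡ true →
    F (cls (cornerPt c k)) c ≡ true × dist (cornerPt c (opp k)) < dist (cornerPt c k)
  up-corner c k Mk with parentCtr-up (does-true (parent? c k) Mk)
  ... | k′ , Fc , e , lt with refl ← cornerPt-injective c k′ k e = Fc , lt

  -- Disjointness of the forests leaves one diagonal through `c`. Were both of its ends matched to
  -- `c`, the distance would decrease strictly in both directions.
  corner-unique : ∀ c k k′ → M (inj₁ (c , k)) ≡ true → M (inj₁ (c , k′)) ≡ true → k ≡ k′
  corner-unique c k k′ Mk Mk′ with up-corner c k Mk | up-corner c k′ Mk′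
  ... | Fc , lt | Fc′ , lt′ with cls-corner c k k′ (F-disjoint c Fc Fc′)
  ...   | inj₁ e    = sym e
  ...   | inj₂ refl = contradiction (subst (λ l → dist (cornerPt c l) < dist (cornerPt c (opp k))) (opp-involutive k) lt′) (<-asym lt)

  ind-false : ∀ {b} → ¬ b ≡ true → ind b ≡ 0
  ind-false {true}  h = contradiction refl h
  ind-false {false} _ = refl

  corner? : ∀ c → Dec (∃ λ k → M (inj₁ (c , k)) ≡ true)
  corner? c = search cornerᴱ λ k → M (inj₁ (c , k)) Bool.≟ true

  degree-zero : ∀ c → ¬ (∃ λ k → M (inj₁ (c , k)) ≡ true) → degree M c ≡ 0
  degree-zero c none = ∑ℕ.∑-zero (elements cornerᴱ) λ k _ → ind-false λ e → none (k , e)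

  degree≤1 : ∀ c → degree M c ≤ 1
  degree≤1 c with corner? c
  ... | no none     = ≤-trans (≤-reflexive (degree-zero c none)) z≤n
  ... | yes (k , e) = ≤-reflexive (degree-one M c e λ {k′} e′ → corner-unique c k k′ e e′)

  -- The number of non-roots equals the number of centers.
  degree≡1 : ∀ c → degree M c ≡ 1
  degree≡1 c = ∑-full (elements (ctrᴱ m n)) (degree M) degree≤1 (≤-reflexive full) (complete (ctrᴱ m n) c)
    where
    full : ∑ℕ.∑ (elements (ctrᴱ m n)) (λ _ → 1) ≡ ∑ℕ.∑ (elements (ctrᴱ m n)) (degree M)
    full = trans (∑-ctrs-one {m} {n}) (+-cancelʳ-≡ (k + k) _ _ (trans (sym (grid-size {m} {n} k size))
      (trans (count-points M point-matched) (cong (λ l → ∑ℕ.∑ (elements (ctrᴱ m n)) (degree M) + (l + l)) count))))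

  isDimer : IsDimer M
  isDimer (inj₁ p) = point-matched p
  isDimer (inj₂ c) with corner? c
  ... | no none = contradiction (trans (sym (degree≡1 c)) (degree-zero c none)) λ ()
  ... | yes (k , e) = inj₁ (c , k) , (e , inj₂ refl) , only
    where
    only : ∀ {e′} → M e′ ≡ true × Incident (inj₂ c) e′ → inj₁ (c , k) ≡ e′
    only {inj₁ (_ , k′)} (e′ , inj₂ refl) = cong (λ k → inj₁ (c , k)) (corner-unique c k k′ e e′)
    only {inj₂ _} (_ , inj₁ ())
    only {inj₂ _} (_ , inj₂ ())

  open Matching M isDimer using (child; corner; matched)

  -- Because every center is matched, it carries an edge of the forest of its child's class, and
  -- disjointness rules out the other forest. So the given forests have no edges beyond those that
  -- were oriented.
  forest-≡ : ∀ j c → (cls (child c) == j) ≡ F j c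
  forest-≡ j c = Bool-≡ (λ e → subst (λ j → F j c ≡ true) (==⇒≡ e) Fc)
    (λ e → subst (λ j → (cls (child c) == j) ≡ true) (F-disjoint c Fc e) (==-refl (cls (child c))))
    where
    Fc : F (cls (child c)) c ≡ true
    Fc = proj₁ (up-corner c (corner c) (proj₁ (proj₂ (matched c))))

-- A dimer covering is determined by its triple

module _ {m n : ℕ} {M M′ : Edge m n → Bool} (D : IsDimer M) (D′ : IsDimer M′) where

  private
    module A = Matching M D
    module B = Matching M′ D′

  corner-cong : (∀ e → M e ≡ M′ e) → ∀ c → A.corner c ≡ B.corner c
  corner-cong eq c = proj₂ (proj₂ (A.matched c)) (trans (eq _) (proj₁ (proj₂ (B.matched c))))

  module _ (impurities : ∀ e → M (inj₂ e) ≡ M′ (inj₂ e)) (classes : ∀ c → cls (A.child c) ≡ cls (B.child c)) where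

    -- Equal classes mean that at `c` the coverings agree or use opposite ends of one diagonal. The
    -- induction is on the number of steps in the orientation of `M` from `A.child c` to its root;
    -- an end on an impurity cannot be a child in either covering, since the impurities coincide.
    same-corner : ∀ i c → A.Root (A.iter i (A.child c)) → B.corner c ≡ A.corner c
    same-corner zero    c r = contradiction r (A.NonRoot⇒¬Root (c , refl))
    same-corner (suc i) c r with cls-corner c (A.corner c) (B.corner c) (classes c)
    ... | inj₁ e = e
    ... | inj₂ e = [ reversed , (λ (e₁ , I₁ , end) → contradiction
              (e₁ , trans (sym (impurities e₁)) I₁ , end) (B.NonRoot⇒¬Root (c , child-B))) ]′ (A.classify (A.parent c))
      where
      child-B : B.child c ≡ A.parent c
      child-B = cong (cornerPt c) e
      -- The edge c is traversed from its A-parent q in B, and so, by induction, in A.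
      reversed : A.NonRoot (A.parent c) → B.corner c ≡ A.corner c
      reversed (c₁ , e₁) = contradiction
        (cornerPt-injective c _ _ (trans (cong A.child (sym c₁≡c)) e₁)) (opp-≢ (A.corner c))
        where
        below : A.Root (A.iter i (A.child c₁))
        below = subst (A.Root ∘ A.iter i) (trans (A.next-child c) (sym e₁)) r
        c₁≡c : c₁ ≡ c
        c₁≡c = B.child-injective (trans (cong (cornerPt c₁) (same-corner i c₁ below)) (trans e₁ (sym child-B)))

    matching-unique : (∀ p → ∃ λ i → A.Root (A.iter i p)) → ∀ e → M e ≡ M′ e
    matching-unique settled (inj₂ e) = impurities e
    matching-unique settled (inj₁ (c , k)) = Bool-≡
      (λ e → subst (λ k → M′ (inj₁ (c , k)) ≡ true) (trans same (proj₂ (proj₂ (A.matched c)) e)) (proj₁ (proj₂ (B.matched c))))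
      (λ e → subst (λ k → M (inj₁ (c , k)) ≡ true) (trans (sym same) (proj₂ (proj₂ (B.matched c)) e)) (proj₁ (proj₂ (A.matched c))))
      where
      same : B.corner c ≡ A.corner c
      same = same-corner (proj₁ (settled (A.child c))) c (proj₂ (settled (A.child c)))

theorem1 : ∀ (m n : ℕ) → 1 ≤ m → 1 ≤ n → (k : ℕ) → m + n + 1 ≡ 2 * k →
    Bijection (DimerSetoid m n) (TripleSetoid m n k)
theorem1 m n 1≤m 1≤n k size = record
  { to        = to
  ; cong      = λ {x} {y} → to-cong {x} {y}
  ; bijective = (λ {x} {y} → to-injective {x} {y}) , to-surjective
  }
  where
  to : Dimers m n → Triples m n k
  to (M , D) = Forest one , Forest two , Impurity , isTriple k size
    where open DimerForest M D (suc m * suc n) (settles 1≤m 1≤n M D (suc m * suc n) refl)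

  to-cong : ∀ {x y : Dimers m n} → (∀ e → proj₁ x e ≡ proj₁ y e) → to x ≈T to y
  to-cong {M , D} {M′ , D′} eq = forests one , forests two , λ e → eq (inj₂ e)
    where
    forests : ∀ j c → (cls (Matching.child M D c) == j) ≡ (cls (Matching.child M′ D′ c) == j)
    forests j c = cong (λ k → cls (cornerPt c k) == j) (corner-cong D D′ eq c)

  to-injective : ∀ {x y : Dimers m n} → to x ≈T to y → ∀ e → proj₁ x e ≡ proj₁ y e
  to-injective {M , D} {M′ , D′} (f₁ , f₂ , f) = matching-unique D D′ f classes
    λ p → suc m * suc n , settles 1≤m 1≤n M D (suc m * suc n) refl p
    where
    classes : ∀ c → cls (Matching.child M D c) ≡ cls (Matching.child M′ D′ c)
    classes c = same _ _ (f₁ c)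
      where
      same : ∀ i j → (i == one) ≡ (j == one) → i ≡ j
      same one one _ = refl
      same two two _ = refl

  to-surjective : ∀ t → ∃ λ x → ∀ {z : Dimers m n} → (∀ e → proj₁ z e ≡ proj₁ x e) → to z ≈T t
  to-surjective (F₁ , F₂ , I , _ , _ , count , disjoint , paired₁ , paired₂) = (M , isDimer) , λ {z} eq →
    let (e₁ , e₂ , e) = to-cong {z} {M , isDimer} eq
    in (λ c → trans (e₁ c) (forest-≡ one c)) , (λ c → trans (e₂ c) (forest-≡ two c)) , e
    where
    F : Cls → Ctr m n → Bool
    F one = F₁
    F two = F₂
    paired : ∀ j p → InV j p → OneImpurity j (F j) I p
    paired one = paired₁
    paired two = paired₂
    open FromTriple {k = k} size F I count disjoint (λ p → paired (cls p) p (InV-cls p))
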